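{- The bijections $\psi:\mathrm{revSSYT}\to\mathrm{qKT}^{(1)}$ and $\Gamma:\mathrm{revSSYT}\to\mathcal{A}\mathrm{SSF}$ restrict to bijections $\mathrm{HrevSSYT}\to\mathrm{HqKT}^{(1)}$ and $\mathrm{HrevSSYT}\to\mathrm{HSSF}$ respectively.
   Context: $\mathrm{revSSYT}$: reverse semistandard Young tableaux of all partition shapes (English notation; positive integer entries; rows weakly decrease left to right, columns strictly decrease top to bottom). For a weak composition $a$, $D(a)$ has $a_i$ left-justified boxes in row $i$, row 1 lowest. Quasi-key tableau of shape $a$: filling of $D(a)$ with positive integers such that (1) rows weakly decrease and no entry of row $i$ exceeds $i$; (2) column entries distinct, increasing going up the first column; (3) if $i$ is above $k$ in a column with $i<k$, there is an entry $j>i$ immediately right of $k$; (4) for two rows with the higher strictly longer, an entry $i$ in column $c$ of the lower and $j$ in column $c+1$ of the higher satisfy $i<j$. $\mathrm{qKT}^{(1)}$: all quasi-key tableaux (all shapes) with first-column entries equal to row indices. Triples of $D(a)$ (rows $r<s$): Type A: $\gamma=(r,c),\alpha=(r,c+1),\beta=(s,c+1)$, $a_r\ge a_s$; Type B: $\gamma=(s,c),\alpha=(s,c+1),\beta=(r,c)$, $a_s>a_r$; inversion triple: $\beta>\gamma\ge\alpha$ or $\gamma\ge\alpha>\beta$. $\mathcal{A}\mathrm{SSF}$: all fillings of skyline diagrams $D(a)$ (all $a$) with positive integers, rows weakly decreasing, distinct column entries, all triples inversion triples, first-column entry of each nonempty row $i$ equal to $i$. $\psi$ (right row-filling): with column sets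 $C_1,C_2,\ldots$ of $V$, repeatedly let $k$ be the largest index with $C_k\neq\emptyset$, choose the smallest $y_k\in C_k$, then for $c=k-1,\ldots,1$ the smallest $y_c\in C_c$ with $y_c\ge y_{c+1}$; make $(y_1,\ldots,y_k)$ row $y_1$ of the output and delete these elements; it is known to be a bijection onto $\mathrm{qKT}^{(1)}$. $\Gamma$ (column-filling): column 1 of $\Gamma(V)$ places each entry $i$ of column 1 of $V$ in row $i$; given column $c$, the entries of column $c+1$ of $V$ are placed in decreasing order, each in the lowest row that has an entry in column $c$ weakly larger than it and an unfilled position in column $c+1$; it is known to be a bijection $\mathrm{revSSYT}\to\mathcal{A}\mathrm{SSF}$. A filling $X$ (in any of these three sets) is particle-highest if for every entry value $i$ of $X$, the leftmost occurrence of $i$ is in the first column of $X$ or lies in a column weakly left of some occurrence of $j$, where $j$ is the smallest entry of $X$ larger than $i$. $\mathrm{HrevSSYT}$, $\mathrm{HqKT}^{(1)}$, $\mathrm{HSSF}$ denote the particle-highest elements of $\mathrm{revSSYT}$, $\mathrm{qKT}^{(1)}$, $\mathcal{A}\mathrm{SSF}$. -}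

module Defs where

open import Data.Bool.Base using (Bool; true; false; if_then_else_)
open import Data.List.Base
  using (List; []; _∷_; _++_; map; mapMaybe; filter; foldl; foldr; upTo; last; length; concat)
open import Data.List.Extrema.Nat using (min; max)
open import Data.List.Relation.Unary.All using (All)
open import Data.List.Relation.Unary.Linked using (Linked)
open import Data.Maybe.Base using (Maybe; just; nothing; maybe; fromMaybe)
open import Data.Nat.Base using (ℕ; zero; suc; _≤_; _<_; _≥_; _>_; _≤ᵇ_)
open import Data.Nat.Properties using (_≟_; _≤?_)
open import Data.Product.Base using (∃; ∃-syntax; Σ-syntax; _×_; proj₁)
open import Data.Sum.Base using (_⊎_)
open import Function.Bundles using (Bijection)
open import Level using (0ℓ)
open import Relation.Binary.Bundles using (Setoid)
import Relation.Binary.Construct.On as On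
open import Relation.Binary.PropositionalEquality using (_≡_; _≢_; setoid)
open import Relation.Nullary.Decidable using (¬?)
open import Relation.Unary using (Pred; _∩_)

------------------------------------------------------------------------
-- Fillings of left-justified diagrams

-- A filling is its list of rows, each row read from left to right; its shape
-- is the list of row lengths.  For Young diagrams (English notation) the rows
-- are listed from top to bottom.  For the diagram D(a) of a weak composition
-- they are listed from row 1, the lowest, upwards, and may be empty.
-- Rows and columns are numbered from 1.

Filling : Set
Filling = List (List ℕ)

infix 8 _‼_

_‼_ : {A : Set} → List A → ℕ → Maybe A
[]       ‼ _           = nothing
(x ∷ xs) ‼ 0           = nothing
(x ∷ xs) ‼ 1           = just x
(x ∷ xs) ‼ suc (suc n) = xs ‼ suc n

row : Filling → ℕ → List ℕ
row X r = fromMaybe [] (X ‼ r)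

rowLength : Filling → ℕ → ℕ
rowLength X r = length (row X r)

cell : Filling → ℕ → ℕ → Maybe ℕ
cell X r c = row X r ‼ c

column : Filling → ℕ → List ℕ
column X c = mapMaybe (_‼ c) X

width : Filling → ℕ
width X = max 0 (map length X)

columns : Filling → List (List ℕ)
columns X = map (λ c → column X (suc c)) (upTo (width X))

Positive : Pred Filling 0ℓ
Positive X = All (All (0 <_)) X

RowsWeaklyDecrease : Pred Filling 0ℓ
RowsWeaklyDecrease X = All (Linked _≥_) X

ColumnsDistinct : Pred Filling 0ℓ
ColumnsDistinct X = ∀ {r s c v w} → r < s →
  cell X r c ≡ just v → cell X s c ≡ just w → v ≢ w

FirstColumnIsRowIndex : Pred Filling 0ℓ
FirstColumnIsRowIndex X = ∀ {r v} → cell X r 1 ≡ just v → v ≡ r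

-- Weak compositions differing only by trailing zeros have the same diagram;
-- a filling of the diagram is represented without trailing empty rows.
NoTrailingEmptyRow : Pred Filling 0ℓ
NoTrailingEmptyRow X = last X ≢ just []

------------------------------------------------------------------------
-- Reverse semistandard Young tableaux

record RevSSYT (X : Filling) : Set where
  field
    nonempty-rows     : All (_≢ []) X
    partition-shape   : Linked _≥_ (map length X)
    positive          : Positive X
    rows-decrease     : RowsWeaklyDecrease X
    columns-decrease  : ∀ {r s c v w} → r < s →
                        cell X r c ≡ just v → cell X s c ≡ just w → v > w

------------------------------------------------------------------------
-- Quasi-key tableaux (row s is above row r when r < s)

record QuasiKey (X : Filling) : Set where
  field
    composition-shape : NoTrailingEmptyRow X
    positive          : Positive X
    rows-decrease     : RowsWeaklyDecrease X
    flagged           : ∀ {r c v} → cell X r c ≡ just v → v ≤ r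
    columns-distinct  : ColumnsDistinct X
    first-increasing  : ∀ {r s v w} → r < s →
                        cell X r 1 ≡ just v → cell X s 1 ≡ just w → v < w
    inversion-right   : ∀ {r s c i k} → r < s →
                        cell X s c ≡ just i → cell X r c ≡ just k → i < k →
                        ∃[ j ] cell X r (suc c) ≡ just j × i < j
    longer-above      : ∀ {r s c i j} → r < s → rowLength X r < rowLength X s →
                        cell X r c ≡ just i → cell X s (suc c) ≡ just j → i < j

record QKT¹ (X : Filling) : Set where
  field
    quasiKey     : QuasiKey X
    first-column : FirstColumnIsRowIndex X

------------------------------------------------------------------------
-- Semi-skyline fillings

InversionTriple : (γ α β : ℕ) → Set
InversionTriple γ α β = (β > γ × γ ≥ α) ⊎ (γ ≥ α × α > β)

record ASSF (X : Filling) : Set where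
  field
    composition-shape : NoTrailingEmptyRow X
    positive          : Positive X
    rows-decrease     : RowsWeaklyDecrease X
    columns-distinct  : ColumnsDistinct X
    type-A            : ∀ {r s c γ α β} → r < s → rowLength X r ≥ rowLength X s →
                        cell X r c ≡ just γ → cell X r (suc c) ≡ just α →
                        cell X s (suc c) ≡ just β → InversionTriple γ α β
    type-B            : ∀ {r s c γ α β} → r < s → rowLength X s > rowLength X r →
                        cell X s c ≡ just γ → cell X s (suc c) ≡ just α →
                        cell X r c ≡ just β → InversionTriple γ α β
    first-column      : FirstColumnIsRowIndex X

------------------------------------------------------------------------
-- Particle-highest fillings

OccursIn : Filling → (c v : ℕ) → Set
OccursIn X c v = ∃[ r ] cell X r c ≡ just v

Entry : Filling → Pred ℕ 0ℓ
Entry X v = ∃[ c ] OccursIn X c v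

LeftmostColumn : Filling → (v c : ℕ) → Set
LeftmostColumn X v c = OccursIn X c v × (∀ {d} → OccursIn X d v → c ≤ d)

NextEntry : Filling → (i j : ℕ) → Set
NextEntry X i j = (Entry X j × i < j) × (∀ {k} → Entry X k → i < k → j ≤ k)

ParticleHighest : Pred Filling 0ℓ
ParticleHighest X = ∀ {i c} → LeftmostColumn X i c →
  c ≡ 1 ⊎ ∃[ j ] NextEntry X i j × ∃[ d ] OccursIn X d j × c ≤ d

HRevSSYT HQKT¹ HSSF : Pred Filling 0ℓ
HRevSSYT = RevSSYT ∩ ParticleHighest
HQKT¹    = QKT¹ ∩ ParticleHighest
HSSF     = ASSF ∩ ParticleHighest

------------------------------------------------------------------------
-- Right row-filling ψ

-- ψ and Γ are total functions on fillings; the branches in which no suitable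
-- entry or row exists are never reached from a reverse tableau.

smallest≥ : ℕ → List ℕ → Maybe ℕ
smallest≥ b C with filter (b ≤?_) C
... | []     = nothing
... | y ∷ ys = just (min y ys)

-- From the columns C₁, C₂, … (as lists) to (y₁ , … , yₖ): the recursive call
-- on the columns further right yields the empty row exactly when these
-- columns are all empty.
extendRow : List ℕ → List ℕ → List ℕ
extendRow C []       = maybe (λ y → y ∷ [])      []       (smallest≥ 0 C)
extendRow C (z ∷ zs) = maybe (λ y → y ∷ z ∷ zs)  (z ∷ zs) (smallest≥ z C)

nextRow : List (List ℕ) → List ℕ
nextRow = foldr extendRow []

deleteRow : List ℕ → List (List ℕ) → List (List ℕ)
deleteRow (y ∷ ys) (C ∷ Cs) = filter (λ x → ¬? (x ≟ y)) C ∷ deleteRow ys Cs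
deleteRow _        Cs       = Cs

placeRow : ℕ → List ℕ → Filling → Filling
placeRow 0             ys X       = X
placeRow 1             ys []      = ys ∷ []
placeRow 1             ys (_ ∷ X) = ys ∷ X
placeRow (suc (suc r)) ys []      = [] ∷ placeRow (suc r) ys []
placeRow (suc (suc r)) ys (x ∷ X) = x ∷ placeRow (suc r) ys X

-- The first argument bounds the number of iterations.
rowFill : ℕ → List (List ℕ) → Filling
rowFill zero    Cs = []
rowFill (suc n) Cs with nextRow Cs
... | []     = []
... | y ∷ ys = placeRow y (y ∷ ys) (rowFill n (deleteRow (y ∷ ys) Cs))

-- Every iteration deletes at least one entry, so the number of entries is a
-- sufficient bound.
ψ : Filling → Filling
ψ V = rowFill (length (concat V)) (columns V)

------------------------------------------------------------------------
-- Column-filling Γ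

-- Can x go immediately right of a row's entry in column c, given the contents
-- of this row in columns c and c + 1?
fits : ℕ → Maybe ℕ → Maybe ℕ → Bool
fits x (just v) nothing = x ≤ᵇ v
fits x _        _       = false

-- Places x in column c + 1.
placeEntry : ℕ → Filling → ℕ → Filling
placeEntry c []      x = []
placeEntry c (R ∷ X) x =
  if fits x (R ‼ c) (R ‼ suc c) then (R ++ x ∷ []) ∷ X else R ∷ placeEntry c X x

-- Given X filled up to column c, fills the columns from c + 1 onwards.  The
-- columns of a reverse tableau, read from top to bottom, list their entries
-- in decreasing order.
columnFill : ℕ → Filling → List (List ℕ) → Filling
columnFill c X []       = X
columnFill c X (C ∷ Cs) = columnFill (suc c) (foldl (placeEntry c) X C) Cs

firstColumn : List ℕ → Filling
firstColumn = foldr (λ i → placeRow i (i ∷ [])) []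

Γ : Filling → Filling
Γ V with columns V
... | []     = []
... | C ∷ Cs = columnFill 1 (firstColumn C) Cs

------------------------------------------------------------------------
-- Restriction to a bijection

subset : Pred Filling 0ℓ → Setoid 0ℓ 0ℓ
subset P = On.setoid {B = ∃ P} (setoid Filling) proj₁

RestrictsToBijection : (Filling → Filling) → Pred Filling 0ℓ → Pred Filling 0ℓ → Set
RestrictsToBijection f P Q =
  Σ[ b ∈ Bijection (subset P) (subset Q) ] (∀ V → proj₁ (Bijection.to b V) ≡ f (proj₁ V))

{-# OPTIONS --safe #-}
-- Being particle-highest depends only on the set of entries of every column, and so it suffices that
-- ψ and Γ preserve these sets, that each of the three families contains at most one filling with
-- given column sets, and that the column sets of any filling with weakly decreasing rows are those
-- of a reverse tableau: the columns, sorted, dominate each other, by counting the entries ≥ t.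
-- Uniqueness is a greedy argument in each family.  For quasi-key tableaux, order the rows by
-- decreasing length and then upwards: the conditions then say exactly that each row is the row which
-- ψ would extract next from the remaining entries.  For skyline fillings, the triple conditions say
-- that no entry fits in a lower row than its own at the moment when Γ places it.
module Submission where

open import Defs
open import Data.Product using (_×_)
open import Data.Bool.Base using (true; false; T)
open import Data.List.Base
  using (List; []; _∷_; _++_; map; last; length; applyUpTo; filter; foldr; foldl; concat; concatMap)
import Data.List.Extrema.Nat as Extrema
open import Data.List.Membership.Propositional using (_∈_; find)
open import Data.List.Membership.Propositional.Properties
  using (∈-filter⁺; ∈-filter⁻; ∈-∃++; ∈-map⁺; ∈-map⁻)
open import Data.List.Properties
  using (filter-accept; filter-reject; filter-none; filter-all; filter-++; length-filter; length-++; foldr-map)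
open import Data.List.Relation.Binary.Permutation.Propositional
  using (_↭_; prep; swap; ↭-refl; ↭-sym; ↭-trans; ↭⇒↭ₛ)
open import Data.List.Relation.Binary.Permutation.Propositional.Properties
  using (↭-length; filter-↭; ∈-resp-↭; ↭-empty-inv; shift)
import Data.List.Relation.Binary.Permutation.Setoid.Properties as PermSetoid
open import Data.List.Relation.Unary.All as All using (All; []; _∷_)
import Data.List.Relation.Unary.All.Properties as All
open import Data.List.Relation.Unary.AllPairs as AllPairs using (AllPairs; []; _∷_)
import Data.List.Relation.Unary.AllPairs.Properties as AllPairs
open import Data.List.Relation.Unary.Any using (Any; here; there)
open import Data.List.Relation.Unary.Linked as Linked using (Linked; []; [-]; _∷_)
open import Data.List.Relation.Unary.Linked.Properties as Linked using (Linked⇒AllPairs; AllPairs⇒Linked)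
open import Data.List.Relation.Unary.Unique.Propositional using (Unique)
import Data.List.Sort as Sort
open import Data.Maybe.Base using (Maybe; just; nothing; fromMaybe)
open import Data.Maybe.Properties using (just-injective)
open import Data.Nat.Base hiding (compare)
open import Data.Nat.Properties
open import Data.Product using (_,_; proj₁; proj₂; ∃-syntax)
open import Data.Product.Relation.Binary.Lex.NonStrict using (×-decTotalOrder)
open import Data.Sum.Base using (_⊎_; inj₁; inj₂)
open import Function.Base using (_∘_; id)
open import Level using (0ℓ)
open import Relation.Binary.Bundles using (DecTotalOrder)
import Relation.Binary.Construct.Flip.EqAndOrd as Flip
import Relation.Binary.Construct.On as On
open import Relation.Binary.Definitions using (Symmetric; tri<; tri≈; tri>)
open import Relation.Binary.PropositionalEquality
open import Relation.Nullary using (¬_; contradiction; yes; no)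
open import Relation.Nullary.Decidable using (¬?)
open import Relation.Unary using (Pred; _∩_)

-- No inverse of `ψ` or `Γ` is constructed. A preimage of `X` is the reverse tableau with the column
-- sets of `X`; its image lies in the same family as `X` and has the same column sets, hence equals
-- `X`. The obstacle is that the conditions on quasi-key and skyline fillings speak of the finished
-- diagram, through row lengths and row positions, whereas the algorithms build it piece by piece.
-- Each family is therefore described anew without lengths: by `Beats` between the rows in their
-- order of extraction, and by `Packed`. Both descriptions serve twice, as what the algorithm
-- establishes and as the hypothesis of uniqueness. The second invariant is the domination `≽`. It
-- guarantees that the greedy searches never fail, so that the fallback branches of the definitions
-- are not reached; the work lies in showing that it survives the extraction of a row and the
-- placement of an entry.

private variable
  A : Set
  c d r s t v w x y : ℕ
  R S C D xs : List ℕ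
  X Y V W : Filling


-- Lookup

-- Lookup splits the list before the index, so this does not hold by computation. Positions are
-- numbered from 1, and position 0 is always vacant.
‼-zero : (xs : List A) → xs ‼ 0 ≡ nothing
‼-zero []      = refl
‼-zero (_ ∷ _) = refl

‼-ext : {xs ys : List A} → (∀ c → xs ‼ c ≡ ys ‼ c) → xs ≡ ys
‼-ext {xs = []}     {[]}     eq = refl
‼-ext {xs = []}     {y ∷ ys} eq with () ← eq 1
‼-ext {xs = x ∷ xs} {[]}     eq with () ← eq 1
‼-ext {xs = x ∷ xs} {y ∷ ys} eq = cong₂ _∷_ (just-injective (eq 1)) (‼-ext tails)
  where
  tails : ∀ c → xs ‼ c ≡ ys ‼ c
  tails zero    = trans (‼-zero xs) (sym (‼-zero ys))
  tails (suc c) = eq (suc (suc c))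

‼-just⇒≤length : {a : A} (xs : List A) → xs ‼ c ≡ just a → c ≤ length xs
‼-just⇒≤length {c = zero}        xs       eq = z≤n
‼-just⇒≤length {c = suc zero}    (x ∷ xs) eq = s≤s z≤n
‼-just⇒≤length {c = suc (suc c)} (x ∷ xs) eq = s≤s (‼-just⇒≤length xs eq)

<length⇒‼-just : (xs : List A) → c < length xs → ∃[ a ] xs ‼ suc c ≡ just a
<length⇒‼-just {c = zero}  (x ∷ xs) c<        = x , refl
<length⇒‼-just {c = suc c} (x ∷ xs) (s≤s c<) = <length⇒‼-just xs c<

length≤⇒‼-nothing : (xs : List A) → length xs ≤ c → xs ‼ suc c ≡ nothing
length≤⇒‼-nothing []                   _        = refl
length≤⇒‼-nothing {c = suc c} (x ∷ xs) (s≤s ≤c) = length≤⇒‼-nothing xs ≤c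

‼-just-pred : {a : A} (xs : List A) → xs ‼ suc (suc c) ≡ just a → ∃[ b ] xs ‼ suc c ≡ just b
‼-just-pred xs eq = <length⇒‼-just xs (<⇒≤ (‼-just⇒≤length xs eq))

just≢nothing : {a : A} {m : Maybe A} → m ≡ just a → m ≢ nothing
just≢nothing refl ()

‼-index : {a : A} (xs : List A) → xs ‼ c ≡ just a → ∃[ d ] c ≡ suc d
‼-index {c = zero}  xs eq = contradiction (‼-zero xs) (just≢nothing eq)
‼-index {c = suc c} xs eq = c , refl

∈⇒‼ : {a : A} {xs : List A} → a ∈ xs → ∃[ c ] xs ‼ suc c ≡ just a
∈⇒‼ (here refl) = 0 , refl
∈⇒‼ (there a∈)  = let c , eq = ∈⇒‼ a∈ in suc c , eq

‼⇒∈ : {a : A} (xs : List A) → xs ‼ c ≡ just a → a ∈ xs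
‼⇒∈ {c = suc zero}    (x ∷ xs) refl = here refl
‼⇒∈ {c = suc (suc c)} (x ∷ xs) eq   = there (‼⇒∈ xs eq)

‼-snoc-old : (xs : List A) {a : A} → c ≤ length xs → (xs ++ a ∷ []) ‼ c ≡ xs ‼ c
‼-snoc-old {c = zero}        xs       c≤       = trans (‼-zero (xs ++ _)) (sym (‼-zero xs))
‼-snoc-old {c = suc zero}    (x ∷ xs) c≤       = refl
‼-snoc-old {c = suc (suc c)} (x ∷ xs) (s≤s c≤) = ‼-snoc-old xs c≤

‼-snoc-new : (xs : List A) {a : A} → (xs ++ a ∷ []) ‼ suc (length xs) ≡ just a
‼-snoc-new []       = refl
‼-snoc-new (x ∷ xs) = ‼-snoc-new xs

Linked⇒pair : {P : ℕ → ℕ → Set} → Linked P xs →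
              xs ‼ c ≡ just v → xs ‼ suc c ≡ just w → P v w
Linked⇒pair {c = suc zero}    (p ∷ l) refl refl = p
Linked⇒pair {c = suc (suc c)} (p ∷ l) eq   eq′  = Linked⇒pair {c = suc c} l eq eq′
Linked⇒pair {c = suc zero}    [-]     eq   ()
Linked⇒pair {xs} {c = zero}   _       eq   eq′  = contradiction (‼-zero xs) (just≢nothing eq)

decreasing-pred : Linked _≥_ xs → xs ‼ suc (suc c) ≡ just w →
                  ∃[ v ] xs ‼ suc c ≡ just v × v ≥ w
decreasing-pred {xs} l eq = let v , eq′ = ‼-just-pred xs eq in v , eq′ , Linked⇒pair l eq′ eq

AllPairs⇒‼ : {P : A → A → Set} {xs : List A} {a b : A} → AllPairs P xs → r < s →
             xs ‼ r ≡ just a → xs ‼ s ≡ just b → P a b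
AllPairs⇒‼ {r = suc zero}    {suc (suc s)} {xs = x ∷ xs} (p ∷ ps) r<s refl eq =
  All.lookup p (‼⇒∈ xs eq)
AllPairs⇒‼ {r = suc (suc r)} {suc (suc s)} (p ∷ ps) (s≤s r<s) eq eq′ = AllPairs⇒‼ ps r<s eq eq′
AllPairs⇒‼ {r = suc (suc r)} {suc zero} (p ∷ ps) (s≤s ()) eq eq′
AllPairs⇒‼ {r = zero} (p ∷ ps) r<s () eq′
AllPairs⇒‼ {r = suc zero} {suc zero} (p ∷ ps) (s≤s ()) eq eq′

-- Rows, cells and columns

Occurs : ℕ → ℕ → List ℕ → Set
Occurs c v R = R ‼ c ≡ just v

row-zero : ∀ X → row X 0 ≡ []
row-zero []      = refl
row-zero (_ ∷ _) = refl

cell⇒row-index : ∀ X → cell X r c ≡ just v → ∃[ q ] r ≡ suc q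
cell⇒row-index {r = zero}  X eq rewrite row-zero X with () ← eq
cell⇒row-index {r = suc r} X eq = r , refl

cell⇒∈ : ∀ X → cell X r c ≡ just v → row X r ∈ X
cell⇒∈ {r = zero}        (R ∷ X) ()
cell⇒∈ {r = suc zero}    (R ∷ X) eq = here refl
cell⇒∈ {r = suc (suc r)} (R ∷ X) eq = there (cell⇒∈ X eq)

∈⇒row : R ∈ X → ∃[ r ] row X (suc r) ≡ R
∈⇒row (here refl) = 0 , refl
∈⇒row (there R∈)  = let r , eq = ∈⇒row R∈ in suc r , eq

All⇒row : {P : List ℕ → Set} → P [] → All P X → ∀ r → P (row X r)
All⇒row p []       r             = p
All⇒row p (q ∷ qs) zero          = p
All⇒row p (q ∷ qs) (suc zero)    = q
All⇒row p (q ∷ qs) (suc (suc r)) = All⇒row p qs (suc r)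

row⇒All : {P : List ℕ → Set} → (∀ r → P (row X r)) → All P X
row⇒All {P = P} p = All.tabulate λ R∈ → let r , eq = ∈⇒row R∈ in subst P eq (p (suc r))

occurs⇒any : ∀ X → OccursIn X c v → Any (Occurs c v) X
occurs⇒any (R ∷ X) (zero        , ())
occurs⇒any (R ∷ X) (suc zero    , eq) = here eq
occurs⇒any (R ∷ X) (suc (suc r) , eq) = there (occurs⇒any X (suc r , eq))

any⇒occurs : Any (Occurs c v) X → ∃[ r ] cell X (suc r) c ≡ just v
any⇒occurs (here eq) = 0 , eq
any⇒occurs (there p) = let r , eq = any⇒occurs p in suc r , eq

any⇒∈column : Any (Occurs c v) X → v ∈ column X c
any⇒∈column {c} {X = R ∷ X} p with R ‼ c in eq | p
... | nothing | here eq′ = contradiction eq (just≢nothing eq′)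
... | nothing | there q  = any⇒∈column q
... | just _  | here eq′ = here (just-injective (trans (sym eq′) eq))
... | just _  | there q  = there (any⇒∈column q)

∈column⇒any : ∀ X → v ∈ column X c → Any (Occurs c v) X
∈column⇒any {c = c} (R ∷ X) v∈ with R ‼ c in eq | v∈
... | nothing | v∈        = there (∈column⇒any X v∈)
... | just _  | here refl = here eq
... | just _  | there v∈  = there (∈column⇒any X v∈)

occurs⇒∈column : ∀ X → OccursIn X c v → v ∈ column X c
occurs⇒∈column X = any⇒∈column ∘ occurs⇒any X

∈column⇒occurs : ∀ X → v ∈ column X c → OccursIn X c v
∈column⇒occurs X v∈ = let r , eq = any⇒occurs (∈column⇒any X v∈) in suc r , eq

-- Turns a condition on the entries of one column into a relation between whole rows, vacuous where
-- an entry is missing, so that it can be carried along when rows are filtered or sorted.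
Cellwise : (ℕ → ℕ → Set) → ℕ → List ℕ → List ℕ → Set
Cellwise P c R S = ∀ v w → R ‼ c ≡ just v → S ‼ c ≡ just w → P v w

cells⇒AllPairs : {P : ℕ → ℕ → Set} (X : Filling) → (∀ {r s v w} → r < s →
                   cell X r c ≡ just v → cell X s c ≡ just w → P v w) →
                 AllPairs (Cellwise P c) X
cells⇒AllPairs []      p = []
cells⇒AllPairs {c} {P} (R ∷ X) p =
  All.tabulate (λ S∈ _ _ eq eq′ → let s , row≡ = ∈⇒row S∈ in
                  p {1} {suc (suc s)} (s≤s (s≤s z≤n)) eq (trans (cong (_‼ _) row≡) eq′)) ∷
  cells⇒AllPairs X λ {r} {s} → shifted r s
  where
  shifted : ∀ r s {v w} → r < s → cell X r c ≡ just v → cell X s c ≡ just w → P v w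
  shifted r s r<s eq eq′ with cell⇒row-index {r} {c} X eq | cell⇒row-index {s} {c} X eq′
  ... | q , refl | q′ , refl = p {suc (suc q)} {suc (suc q′)} (s≤s r<s) eq eq′

AllPairs-column : {P : ℕ → ℕ → Set} (X : Filling) → AllPairs (Cellwise P c) X → AllPairs P (column X c)
AllPairs-column {c} []      []       = []
AllPairs-column {c} (R ∷ X) (p ∷ ps) with R ‼ c in eq
... | nothing = AllPairs-column X ps
... | just v  = All.tabulate (λ w∈ → let S , S∈ , eq′ = find (∈column⇒any X w∈) in
                                     All.lookup p S∈ _ _ refl eq′) ∷
                AllPairs-column X ps

column⇒< : ∀ X → column X (suc c) ≢ [] → c < width X
column⇒< {c} X ne with c <? width X
... | yes c<w = c<w
... | no  c≮w = contradiction (empty X (All.tabulate λ R∈ →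
                  ≤-trans (All.lookup (Extrema.xs≤max 0 (map length X)) R∈) (≮⇒≥ c≮w))) ne
  where
  empty : ∀ X → All (_≤ c) (map length X) → column X (suc c) ≡ []
  empty []      _        = refl
  empty (R ∷ X) (p ∷ ps) rewrite length≤⇒‼-nothing R p = empty X ps

<width⇒column : ∀ X → c < width X → column X (suc c) ≢ []
<width⇒column {c} X c<w empty = <⇒≱ c<w (Extrema.max≤v⁺ {xs = map length X} z≤n (short X empty))
  where
  short : ∀ X → column X (suc c) ≡ [] → All (_≤ c) (map length X)
  short []      _     = []
  short (R ∷ X) empty with R ‼ suc c in eq | empty
  ... | nothing | empty = ≮⇒≥ (λ c< → let a , eq′ = <length⇒‼-just R c< in
                                       just≢nothing eq′ eq) ∷ short X empty
  ... | just _  | ()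

-- Beyond the width both sides are empty: `row` by its default, `column` because no row is that
-- long.
row-columns : ∀ X c → row (columns X) (suc c) ≡ column X (suc c)
row-columns X c with c <? width X
... | yes c<w = lookup-map id (width X) c c<w
  where
  lookup-map : (f : ℕ → ℕ) → ∀ n c → c < n →
               row (map (λ c → column X (suc c)) (applyUpTo f n)) (suc c) ≡ column X (suc (f c))
  lookup-map f (suc n) zero    c<n       = refl
  lookup-map f (suc n) (suc c) (s≤s c<n) = lookup-map (f ∘ suc) n c c<n
... | no  c≮w with column X (suc c) in eq
... | [] = beyond id (width X) c (≮⇒≥ c≮w)
  where
  beyond : (f : ℕ → ℕ) → ∀ n c → n ≤ c →
           row (map (λ c → column X (suc c)) (applyUpTo f n)) (suc c) ≡ []
  beyond f zero    c       n≤c       = refl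
  beyond f (suc n) (suc c) (s≤s n≤c) = beyond (f ∘ suc) n c n≤c
... | _ ∷ _ = contradiction (column⇒< X λ eq′ → contradiction (trans (sym eq) eq′) λ ()) c≮w

-- `column` skips the rows that are too short, so its positions need not be row numbers. When the
-- lengths decrease, the skipped rows are the last ones and no position shifts.
column-‼ : AllPairs _≥_ (map length X) → ∀ r → column X c ‼ r ≡ cell X r c
column-‼ {X} {zero} sh r = trans (cong (_‼ r) (no-column-zero X)) (sym (‼-zero (row X r)))
  where
  no-column-zero : ∀ X → column X 0 ≡ []
  no-column-zero []      = refl
  no-column-zero (R ∷ X) rewrite ‼-zero R = no-column-zero X
column-‼ {[]}    {suc c} sh r = refl
column-‼ {R ∷ X} {suc c} (p ∷ ps) r with R ‼ suc c in eq
column-‼ {R ∷ X} {suc c} (p ∷ ps) zero          | just v = refl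
column-‼ {R ∷ X} {suc c} (p ∷ ps) (suc zero)    | just v = sym eq
column-‼ {R ∷ X} {suc c} (p ∷ ps) (suc (suc r)) | just v = column-‼ {X} ps (suc r)
column-‼ {R ∷ X} {suc c} (p ∷ ps) r             | nothing = trans (cong (_‼ r) (empty X p)) (sym (none r))
  where
  R≤c : length R ≤ c
  R≤c = ≮⇒≥ λ c< → let a , eq′ = <length⇒‼-just R c< in just≢nothing eq′ eq
  empty : ∀ X → All (length R ≥_) (map length X) → column X (suc c) ≡ []
  empty []      _        = refl
  empty (S ∷ X) (p ∷ ps) rewrite length≤⇒‼-nothing S (≤-trans p R≤c) = empty X ps
  none : ∀ r → cell (R ∷ X) r (suc c) ≡ nothing
  none zero          = refl
  none (suc zero)    = eq
  none (suc (suc r)) = trans (sym (column-‼ {X} ps (suc r))) (cong (_‼ suc r) (empty X p))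

-- `row` gives `[]` both for an empty row and beyond the last row. Trailing empty rows are thus all
-- that it cannot see.
row-ext : NoTrailingEmptyRow X → NoTrailingEmptyRow Y → (∀ r → row X r ≡ row Y r) → X ≡ Y
row-ext {[]}    {[]}    nX nY eq = refl
row-ext {[]}    {S ∷ Y} nX nY eq = contradiction (all-empty S Y λ r → sym (eq (suc r))) nY
  where
  all-empty : ∀ S Y → (∀ r → row (S ∷ Y) (suc r) ≡ []) → last (S ∷ Y) ≡ just []
  all-empty S []      eq = cong just (eq 0)
  all-empty S (T ∷ Y) eq = all-empty T Y (eq ∘ suc)
row-ext {R ∷ X} {[]} nX nY eq = sym (row-ext nY nX (sym ∘ eq))
row-ext {R ∷ X} {S ∷ Y} nX nY eq = cong₂ _∷_ (eq 1) (row-ext (tail R X nX) (tail S Y nY) tails)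
  where
  tail : ∀ R X → NoTrailingEmptyRow (R ∷ X) → NoTrailingEmptyRow X
  tail R []      n ()
  tail R (_ ∷ _) n = n
  tails : ∀ r → row X r ≡ row Y r
  tails zero    = trans (row-zero X) (sym (row-zero Y))
  tails (suc r) = eq (suc (suc r))

filling-ext : NoTrailingEmptyRow X → NoTrailingEmptyRow Y →
              (∀ {r c v} → cell X r c ≡ just v → cell Y r c ≡ just v) →
              (∀ {r c v} → cell Y r c ≡ just v → cell X r c ≡ just v) → X ≡ Y
filling-ext {X} {Y} nX nY f g = row-ext nX nY λ r → ‼-ext (cells r)
  where
  cells : ∀ r c → cell X r c ≡ cell Y r c
  cells r c with cell X r c in eq | cell Y r c in eq′
  ... | nothing | nothing = refl
  ... | just v  | _       = trans (sym (f {r} {c} eq)) eq′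
  ... | nothing | just w  = trans (sym eq) (g {r} {c} eq′)

-- Counting large entries

count≥ : ℕ → List ℕ → ℕ
count≥ t C = length (filter (t ≤?_) C)

infix 4 _≽_

-- Hall's condition for matching every entry of `D` with an entry of its own in `C` that is at least
-- as large. It ignores the order of the lists, so it passes from the rows of a filling to its
-- sorted columns.
_≽_ : List ℕ → List ℕ → Set
C ≽ D = ∀ t → count≥ t D ≤ count≥ t C

count≥-accept : ∀ C → t ≤ x → count≥ t (x ∷ C) ≡ suc (count≥ t C)
count≥-accept C t≤x = cong length (filter-accept (_ ≤?_) {xs = C} t≤x)

count≥-reject : ∀ C → x < t → count≥ t (x ∷ C) ≡ count≥ t C
count≥-reject C x<t = cong length (filter-reject (_ ≤?_) {xs = C} (<⇒≱ x<t))

count≥-none : All (_< t) C → count≥ t C ≡ 0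
count≥-none C<t = cong length (filter-none (_ ≤?_) (All.map <⇒≱ C<t))

count≥-↭ : C ↭ D → count≥ t C ≡ count≥ t D
count≥-↭ C↭D = ↭-length (filter-↭ (_ ≤?_) C↭D)

∈⇒count≥ : x ∈ C → t ≤ x → 0 < count≥ t C
∈⇒count≥ {C = C} {t} x∈ t≤x with filter (t ≤?_) C | ∈-filter⁺ (t ≤?_) x∈ t≤x
... | _ ∷ _ | _ = s≤s z≤n

count≥⇒∈ : ∀ C → 0 < count≥ t C → ∃[ x ] x ∈ C × t ≤ x
count≥⇒∈ {t} C 0< with filter (t ≤?_) C in eq
... | y ∷ _ = y , ∈-filter⁻ (t ≤?_) {xs = C} (subst (y ∈_) (sym eq) (here refl))

≽[] : ∀ C → C ≽ []
≽[] C t = z≤n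

[]≽⇒[] : [] ≽ D → D ≡ []
[]≽⇒[] {[]}    _  = refl
[]≽⇒[] {x ∷ D} ge = contradiction (≤-trans (∈⇒count≥ {C = x ∷ D} (here refl) ≤-refl) (ge x)) λ ()

≽-∈ : C ≽ D → x ∈ D → ∃[ y ] y ∈ C × x ≤ y
≽-∈ {C} ge x∈ = count≥⇒∈ C (≤-trans (∈⇒count≥ x∈ ≤-refl) (ge _))

-- At thresholds above `x` nothing in `D` counts. At the others, removing the heads costs the
-- smaller side exactly one and the larger side at most one, whatever `w` is.
≽-∷⁻ : (∀ {y} → y ∈ D → y < x) → w ∷ C ≽ x ∷ D → C ≽ D
≽-∷⁻ {D} {x} {w} {C} D<x ge t with t ≤? x
... | no  t≰x = ≤-trans (≤-reflexive (count≥-none {C = D} (All.tabulate λ y∈ → <-trans (D<x y∈) (≰⇒> t≰x)))) z≤n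
... | yes t≤x with t ≤? w
... | yes t≤w = ≤-pred (subst₂ _≤_ (count≥-accept D t≤x) (count≥-accept C t≤w) (ge t))
... | no  t≰w = <⇒≤ (subst₂ _≤_ (count≥-accept D t≤x) (count≥-reject C (≰⇒> t≰w)) (ge t))

-- Row by row: an entry counted in the right column has a left neighbour at least as large, which is
-- counted as well.
columns-≽ : ∀ X → All (Linked _≥_) X → column X (suc c) ≽ column X (suc (suc c))
columns-≽ []      []       t = z≤n
columns-≽ {c} (R ∷ X) (l ∷ ls) t with R ‼ suc c in eq | R ‼ suc (suc c) in eq′
... | nothing | nothing = columns-≽ X ls t
... | nothing | just w  = let _ , eq″ , _ = decreasing-pred l eq′ in contradiction eq (just≢nothing eq″)
... | just v  | nothing with t ≤? v
...   | yes t≤v = subst (_ ≤_) (sym (count≥-accept (column X (suc c)) t≤v)) (m≤n⇒m≤1+n (columns-≽ X ls t))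
...   | no  t≰v = subst (_ ≤_) (sym (count≥-reject (column X (suc c)) (≰⇒> t≰v))) (columns-≽ X ls t)
columns-≽ {c} (R ∷ X) (l ∷ ls) t | just v | just w with t ≤? w
... | no  t≰w = ≤-trans (≤-reflexive (count≥-reject _ (≰⇒> t≰w)))
                  (≤-trans (columns-≽ X ls t) (count≥-≤-∷ (column X (suc c))))
  where
  count≥-≤-∷ : ∀ C → count≥ t C ≤ count≥ t (v ∷ C)
  count≥-≤-∷ C with t ≤? v
  ... | yes t≤v = subst (_ ≤_) (sym (count≥-accept C t≤v)) (n≤1+n _)
  ... | no  t≰v = ≤-reflexive (sym (count≥-reject C (≰⇒> t≰v)))
... | yes t≤w = subst₂ _≤_ (sym (count≥-accept _ t≤w))
                  (sym (count≥-accept _ (≤-trans t≤w (Linked⇒pair l eq eq′)))) (s≤s (columns-≽ X ls t))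

-- Distinct entries

delete : ℕ → List ℕ → List ℕ
delete y = filter (λ x → ¬? (x ≟ y))

∈-delete⁺ : x ∈ C → x ≢ y → x ∈ delete y C
∈-delete⁺ = ∈-filter⁺ (λ x → ¬? (x ≟ _))

∈-delete⁻ : ∀ C → x ∈ delete y C → x ∈ C × x ≢ y
∈-delete⁻ C = ∈-filter⁻ (λ x → ¬? (x ≟ _)) {xs = C}

delete-↭ : Unique C → y ∈ C → C ↭ y ∷ delete y C
delete-↭ {C = y ∷ C} (y∉ ∷ _) (here refl)
  rewrite filter-reject (λ x → ¬? (x ≟ y)) {xs = C} (λ ne → ne refl)
        | filter-all (λ x → ¬? (x ≟ y)) (All.map ≢-sym y∉) = ↭-refl
delete-↭ {C = x ∷ C} {y} (x∉ ∷ u) (there y∈)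
  rewrite filter-accept (λ x → ¬? (x ≟ y)) {xs = C} (All.lookup x∉ y∈) =
  ↭-trans (prep x (delete-↭ u y∈)) (swap x y ↭-refl)

⊆⇒≽ : Unique C → (∀ {x} → x ∈ C → x ∈ D) → D ≽ C
⊆⇒≽ {[]}    _        C⊆D t = z≤n
⊆⇒≽ {y ∷ C} (y∉ ∷ u) C⊆D t with ∈-∃++ (C⊆D (here refl))
... | D₁ , D₂ , refl = ≤-trans (cons (⊆⇒≽ u C⊆D′ t)) (≤-reflexive (sym (count≥-↭ (shift y D₁ D₂))))
  where
  C⊆D′ : ∀ {x} → x ∈ C → x ∈ D₁ ++ D₂
  C⊆D′ x∈ with ∈-resp-↭ (shift y D₁ D₂) (C⊆D (there x∈))
  ... | here refl  = contradiction refl (All.lookup y∉ x∈)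
  ... | there x∈′  = x∈′
  cons : count≥ t C ≤ count≥ t (D₁ ++ D₂) → count≥ t (y ∷ C) ≤ count≥ t (y ∷ D₁ ++ D₂)
  cons le with t ≤? y
  ... | yes t≤y = subst₂ _≤_ (sym (count≥-accept C t≤y)) (sym (count≥-accept (D₁ ++ D₂) t≤y)) (s≤s le)
  ... | no  t≰y = subst₂ _≤_ (sym (count≥-reject C (≰⇒> t≰y))) (sym (count≥-reject (D₁ ++ D₂) (≰⇒> t≰y))) le

AllPairs-resp-↭ : {P : A → A → Set} → Symmetric P → {xs ys : List A} →
                  xs ↭ ys → AllPairs P xs → AllPairs P ys
AllPairs-resp-↭ {P = P} P-sym xs↭ys = PermSetoid.AllPairs-resp-↭ (setoid _) P-sym (resp₂ P) (↭⇒↭ₛ xs↭ys)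

>⇒Unique : AllPairs _>_ C → Unique C
>⇒Unique = AllPairs.map λ x>y x≡y → <-irrefl (sym x≡y) x>y

Unique-column : ColumnsDistinct X → Unique (column X c)
Unique-column {X} {c} distinct = AllPairs-column X (cells⇒AllPairs X λ {r} {s} → distinct {r} {s} {c})

open module SortDown = Sort (Flip.decTotalOrder ≤-decTotalOrder)
  using () renaming (sort to sortDown; sort-↭ to sortDown-↭; sort-↗ to sortDown-≥)

sortDown-> : Unique C → AllPairs _>_ (sortDown C)
sortDown-> {C} u = AllPairs.zipWith (λ (x≥y , x≢y) → ≤∧≢⇒< x≥y (≢-sym x≢y))
  ( Linked⇒AllPairs (λ y≤x z≤y → ≤-trans z≤y y≤x) (sortDown-≥ C)
  , AllPairs-resp-↭ ≢-sym (↭-sym (sortDown-↭ C)) u )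

-- Pointwise domination of decreasing columns

infix 4 _⊒_

record _⊒_ (C D : List ℕ) : Set where
  constructor pointwise
  field larger : ∀ r v → D ‼ r ≡ just v → ∃[ w ] C ‼ r ≡ just w × v ≤ w
open _⊒_

-- The heads are the maxima: counting supplies some entry of `w ∷ C` that is at least `x`, and it is
-- at most `w`. Both heads can then be dropped by `≽-∷⁻`.
≽⇒⊒ : AllPairs _>_ C → AllPairs _>_ D → C ≽ D → C ⊒ D
≽⇒⊒ {C} {[]} pC pD ge = pointwise λ r v ()
≽⇒⊒ {[]} {x ∷ D} pC pD ge with () ← []≽⇒[] {x ∷ D} ge
≽⇒⊒ {w ∷ C} {x ∷ D} (pw ∷ pC) (px ∷ pD) ge = pointwise larger′
  where
  x≤w : x ≤ w
  x≤w with ≽-∈ {w ∷ C} {x ∷ D} ge (here refl)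
  ... | _ , here refl , x≤w = x≤w
  ... | _ , there y∈  , x≤y = ≤-trans x≤y (<⇒≤ (All.lookup pw y∈))
  larger′ : ∀ r v → (x ∷ D) ‼ r ≡ just v → ∃[ u ] (w ∷ C) ‼ r ≡ just u × v ≤ u
  larger′ (suc zero)    v refl = w , refl , x≤w
  larger′ (suc (suc r)) v eq   = larger (≽⇒⊒ pC pD (≽-∷⁻ {D} {x} {w} {C} (All.lookup px) ge)) (suc r) v eq

⊒-trans : C ⊒ D → D ⊒ R → C ⊒ R
⊒-trans p q = pointwise λ r v eq →
  let _ , eq′ , ≤₁ = larger q r v eq ; _ , eq″ , ≤₂ = larger p r _ eq′ in _ , eq″ , ≤-trans ≤₁ ≤₂

⊒⇒length : C ⊒ D → length C ≥ length D
⊒⇒length {C} {D} ge = ≮⇒≥ λ C<D →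
  let _ , eq = <length⇒‼-just D C<D ; _ , eq′ , _ = larger ge _ _ eq
  in contradiction (‼-just⇒≤length C eq′) 1+n≰n

-- Fillings with the same entries in every column

infix 4 _⊆ᶜ_ _≈ᶜ_

_⊆ᶜ_ : Filling → Filling → Set
X ⊆ᶜ Y = ∀ {c v} → OccursIn X c v → OccursIn Y c v

record _≈ᶜ_ (X Y : Filling) : Set where
  constructor mutual-⊆ᶜ
  field
    ⊆ : X ⊆ᶜ Y
    ⊇ : Y ⊆ᶜ X

≈ᶜ-sym : X ≈ᶜ Y → Y ≈ᶜ X
≈ᶜ-sym (mutual-⊆ᶜ f g) = mutual-⊆ᶜ g f

≈ᶜ-trans : X ≈ᶜ Y → Y ≈ᶜ V → X ≈ᶜ V
≈ᶜ-trans (mutual-⊆ᶜ f g) (mutual-⊆ᶜ f′ g′) = mutual-⊆ᶜ (λ o → f′ (f o)) (λ o → g (g′ o))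

ParticleHighest-resp : X ≈ᶜ Y → ParticleHighest X → ParticleHighest Y
ParticleHighest-resp (mutual-⊆ᶜ f g) ph (occ , least) with ph (g occ , λ o → least (f o))
... | inj₁ c≡1 = inj₁ c≡1
... | inj₂ (j , (((d , o) , i<j) , next) , e , o′ , c≤e) =
  inj₂ (j , (((d , f o) , i<j) , λ (d , o) → next (d , g o)) , e , f o′ , c≤e)

-- Reverse tableaux

partition-shape⇒AllPairs : RevSSYT V → AllPairs _≥_ (map length V)
partition-shape⇒AllPairs p = Linked⇒AllPairs (λ y≤x z≤y → ≤-trans z≤y y≤x) (RevSSYT.partition-shape p)

columns-no-gap : RevSSYT V → cell V s c ≡ just v → suc r ≤ s → ∃[ w ] cell V (suc r) c ≡ just w
columns-no-gap {V} {s} {c} {r = r} p eq r<s =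
  let sh = partition-shape⇒AllPairs p
      len = ‼-just⇒≤length (column V c) (trans (column-‼ {V} sh s) eq)
      w , eq′ = <length⇒‼-just (column V c) (≤-trans r<s len)
  in w , trans (sym (column-‼ {V} sh (suc r))) eq′

RevSSYT⇒NoTrailingEmptyRow : RevSSYT V → NoTrailingEmptyRow V
RevSSYT⇒NoTrailingEmptyRow p = nonempty (RevSSYT.nonempty-rows p)
  where
  nonempty : All (_≢ []) V → NoTrailingEmptyRow V
  nonempty (R≢[] ∷ [])       eq = R≢[] (just-injective eq)
  nonempty (_ ∷ ps@(_ ∷ _))  eq = nonempty ps eq

-- Induction on the row, bounded by `n`. If `v` stood higher in `W`, then by induction it would
-- stand twice in its column of `V`. So `W` has some `w ≥ v` in row `r`; in the same way `w` cannot
-- stand higher than row `r` in `V`, whence `w ≤ v`.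
RevSSYT-cell : ∀ n → RevSSYT V → RevSSYT W → V ⊆ᶜ W → W ⊆ᶜ V → r < n →
               cell V r c ≡ just v → cell W r c ≡ just v
RevSSYT-cell {V} {W} {r} {c} {v} (suc n) pV pW V⊆W W⊆V (s≤s r≤n) eq
  with cell⇒row-index {c = c} V eq | V⊆W (r , eq)
... | q , refl | s , eqs with <-≤-connex s r
... | inj₁ s<r = contradiction
  (RevSSYT.columns-decrease pV s<r (RevSSYT-cell n pW pV W⊆V V⊆W (≤-trans s<r r≤n) eqs) eq) (<-irrefl refl)
... | inj₂ r≤s with columns-no-gap {W} pW eqs r≤s
... | w , eqw with W⊆V (r , eqw)
... | s′ , eqs′ with <-≤-connex s′ r
... | inj₁ s′<r = contradiction
  (RevSSYT.columns-decrease pW s′<r (RevSSYT-cell n pV pW V⊆W W⊆V (≤-trans s′<r r≤n) eqs′) eqw) (<-irrefl refl)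
... | inj₂ r≤s′ = trans eqw (cong just (≤-antisym (below V pV r≤s′ eq eqs′) (below W pW r≤s eqw eqs)))
  where
  below : ∀ V {r s v w} → RevSSYT V → r ≤ s → cell V r c ≡ just v → cell V s c ≡ just w → w ≤ v
  below V {r} {s} p r≤s eq eq′ with m≤n⇒m<n∨m≡n r≤s
  ... | inj₁ r<s  = <⇒≤ (RevSSYT.columns-decrease p r<s eq eq′)
  ... | inj₂ refl = ≤-reflexive (just-injective (trans (sym eq′) eq))

RevSSYT-unique : RevSSYT V → RevSSYT W → V ≈ᶜ W → V ≡ W
RevSSYT-unique pV pW (mutual-⊆ᶜ V⊆W W⊆V) =
  filling-ext (RevSSYT⇒NoTrailingEmptyRow pV) (RevSSYT⇒NoTrailingEmptyRow pW)
    (λ {r} {c} → RevSSYT-cell {c = c} (suc r) pV pW V⊆W W⊆V ≤-refl)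
    (λ {r} {c} → RevSSYT-cell {c = c} (suc r) pW pV W⊆V V⊆W ≤-refl)

-- Existence of a reverse tableau with prescribed columns

rows⇒Linked : {P : List ℕ → List ℕ → Set} → (∀ r → P (row X (suc r)) (row X (suc (suc r)))) → Linked P X
rows⇒Linked {[]}        p = []
rows⇒Linked {R ∷ []}    p = [-]
rows⇒Linked {R ∷ S ∷ X} p = p 0 ∷ rows⇒Linked (p ∘ suc)

length-column : ∀ X c → length (column X (suc c)) ≥ length (column X (suc (suc c)))
length-column []      c = z≤n
length-column (R ∷ X) c with R ‼ suc c in eq | R ‼ suc (suc c) in eq′
... | nothing | nothing = length-column X c
... | just _  | nothing = m≤n⇒m≤1+n (length-column X c)
... | just _  | just _  = s≤s (length-column X c)
... | nothing | just _  = contradiction eq (just≢nothing (proj₂ (‼-just-pred R eq′)))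

-- `Ds` lists the intended columns as rows, so `columns Ds` is the transpose. Pointwise domination
-- gives weakly decreasing rows; it also makes the lengths in `Ds` decrease, which is what
-- identifies cells with transposed cells through `column-‼`.
module Conjugate (Ds : Filling)
  (rows-> : ∀ c → AllPairs _>_ (row Ds (suc c)))
  (rows-⊒ : ∀ c → row Ds (suc c) ⊒ row Ds (suc (suc c)))
  (rows-positive : ∀ c → All (0 <_) (row Ds (suc c)))
  where

  all-⊒ : AllPairs _⊒_ Ds
  all-⊒ = Linked⇒AllPairs ⊒-trans (rows⇒Linked rows-⊒)

  conjugate-cell : ∀ r c → cell (columns Ds) (suc r) c ≡ cell Ds c (suc r)
  conjugate-cell r c = trans (cong (_‼ c) (row-columns Ds r))
    (column-‼ {Ds} (AllPairs.map⁺ (AllPairs.map ⊒⇒length all-⊒)) c)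

  column-≥ : ∀ c → Linked _≥_ (column Ds c)
  column-≥ c = AllPairs⇒Linked (AllPairs-column Ds (AllPairs.map pair all-⊒))
    where
    pair : ∀ {C D} → C ⊒ D → Cellwise _≥_ c C D
    pair C⊒D _ _ eq eq′ =
      let _ , eq″ , le = larger C⊒D _ _ eq′ in subst (_ ≤_) (just-injective (trans (sym eq″) eq)) le

  conjugate-RevSSYT : RevSSYT (columns Ds)
  conjugate-RevSSYT = record
    { nonempty-rows    = All.map⁺ (All.applyUpTo⁺₁ id (width Ds) (<width⇒column Ds))
    ; partition-shape  = Linked.map⁺ (Linked.map⁺ (Linked.applyUpTo⁺₁ id (width Ds) λ {c} _ → length-column Ds c))
    ; positive         = row⇒All positive
    ; rows-decrease    = row⇒All decreasing
    ; columns-decrease = columns-decrease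
    }
    where
    positive : ∀ r → All (0 <_) (row (columns Ds) r)
    positive zero    = subst (All (0 <_)) (sym (row-zero (columns Ds))) []
    positive (suc r) = subst (All (0 <_)) (sym (row-columns Ds r)) (All.tabulate λ v∈ →
      let s , eq = any⇒occurs (∈column⇒any Ds v∈) in All.lookup (rows-positive s) (‼⇒∈ _ eq))
    decreasing : ∀ r → Linked _≥_ (row (columns Ds) r)
    decreasing zero    = subst (Linked _≥_) (sym (row-zero (columns Ds))) []
    decreasing (suc r) = subst (Linked _≥_) (sym (row-columns Ds r)) (column-≥ (suc r))
    columns-decrease : ∀ {r s c v w} → r < s →
                       cell (columns Ds) r c ≡ just v → cell (columns Ds) s c ≡ just w → v > w
    columns-decrease {r} {s} {c} r<s eq eq′
      with cell⇒row-index {c = c} (columns Ds) eq | cell⇒row-index {c = c} (columns Ds) eq′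
         | ‼-index {c = c} (row (columns Ds) r) eq
    ... | r , refl | s , refl | c , refl =
      AllPairs⇒‼ (rows-> c) r<s (trans (sym (conjugate-cell r (suc c))) eq)
                                (trans (sym (conjugate-cell s (suc c))) eq′)

  conjugate-occurs⁻ : OccursIn (columns Ds) c v → v ∈ row Ds c
  conjugate-occurs⁻ {c} (r , eq) with cell⇒row-index {c = c} (columns Ds) eq
  ... | r , refl = ‼⇒∈ _ (trans (sym (conjugate-cell r c)) eq)

  conjugate-occurs⁺ : v ∈ row Ds c → OccursIn (columns Ds) c v
  conjugate-occurs⁺ {c = c} v∈ = let r , eq = ∈⇒‼ v∈ in suc r , trans (conjugate-cell r c) eq

RevSSYT-exists : ∀ X → RowsWeaklyDecrease X → ColumnsDistinct X → Positive X →
                 ∃[ V ] RevSSYT V × V ≈ᶜ X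
RevSSYT-exists X rows distinct positive = columns Ds , conjugate-RevSSYT , mutual-⊆ᶜ to from
  where
  Ds : Filling
  Ds = map sortDown (columns X)

  row-map : (f : List ℕ → List ℕ) → f [] ≡ [] → ∀ Y r → row (map f Y) r ≡ f (row Y r)
  row-map f f[] []      r             = sym f[]
  row-map f f[] (R ∷ Y) zero          = sym f[]
  row-map f f[] (R ∷ Y) (suc zero)    = refl
  row-map f f[] (R ∷ Y) (suc (suc r)) = row-map f f[] Y (suc r)

  row-D : ∀ c → row Ds (suc c) ≡ sortDown (column X (suc c))
  row-D c = trans (row-map sortDown (↭-empty-inv (sortDown-↭ [])) (columns X) (suc c))
                  (cong sortDown (row-columns X c))

  ∈row-D : v ∈ column X (suc c) → v ∈ row Ds (suc c)
  ∈row-D {c = c} v∈ = subst (_ ∈_) (sym (row-D c)) (∈-resp-↭ (↭-sym (sortDown-↭ _)) v∈)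

  ∈row-D⁻ : v ∈ row Ds (suc c) → v ∈ column X (suc c)
  ∈row-D⁻ {c = c} v∈ = ∈-resp-↭ (sortDown-↭ _) (subst (_ ∈_) (row-D c) v∈)

  rows-> : ∀ c → AllPairs _>_ (row Ds (suc c))
  rows-> c = subst (AllPairs _>_) (sym (row-D c)) (sortDown-> (Unique-column {X} distinct))

  rows-≽ : ∀ c → row Ds (suc c) ≽ row Ds (suc (suc c))
  rows-≽ c t rewrite row-D c | row-D (suc c) =
    subst₂ _≤_ (count≥-↭ (↭-sym (sortDown-↭ _))) (count≥-↭ (↭-sym (sortDown-↭ _))) (columns-≽ X rows t)

  rows-positive : ∀ c → All (0 <_) (row Ds (suc c))
  rows-positive c = All.tabulate λ v∈ →
    let r , eq = ∈column⇒occurs X (∈row-D⁻ v∈) in All.lookup (All⇒row [] positive r) (‼⇒∈ _ eq)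

  open Conjugate Ds rows-> (λ c → ≽⇒⊒ (rows-> c) (rows-> (suc c)) (rows-≽ c)) rows-positive

  to : columns Ds ⊆ᶜ X
  to {c} (r , eq) with ‼-index {c = c} (row (columns Ds) r) eq
  ... | c , refl = ∈column⇒occurs X (∈row-D⁻ (conjugate-occurs⁻ (r , eq)))

  from : X ⊆ᶜ columns Ds
  from {c} (r , eq) with ‼-index {c = c} (row X r) eq
  ... | c , refl = conjugate-occurs⁺ (∈row-D (occurs⇒∈column X (r , eq)))

-- Placing rows

place : List ℕ → Filling → Filling
place []       X = X
place (y ∷ ys) X = placeRow y (y ∷ ys) X

-- The list keeps the order in which rows are extracted, which the finished filling forgets. Outputs
-- of `ψ`, arbitrary quasi-key tableaux and the first column of `Γ` are all brought into this form.
placeAll : List (List ℕ) → Filling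
placeAll = foldr place []

row-placeRow-same : ∀ r ys X → row (placeRow (suc r) ys X) (suc r) ≡ ys
row-placeRow-same zero    ys []      = refl
row-placeRow-same zero    ys (_ ∷ X) = refl
row-placeRow-same (suc r) ys []      = row-placeRow-same r ys []
row-placeRow-same (suc r) ys (_ ∷ X) = row-placeRow-same r ys X

row-placeRow-other : ∀ r ys X s → s ≢ suc r → row (placeRow (suc r) ys X) s ≡ row X s
row-placeRow-other r       ys X       zero          ne = trans (row-zero (placeRow (suc r) ys X)) (sym (row-zero X))
row-placeRow-other zero    ys X       (suc zero)    ne = contradiction refl ne
row-placeRow-other zero    ys []      (suc (suc s)) ne = refl
row-placeRow-other zero    ys (_ ∷ X) (suc (suc s)) ne = refl
row-placeRow-other (suc r) ys []      (suc zero)    ne = refl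
row-placeRow-other (suc r) ys (_ ∷ X) (suc zero)    ne = refl
row-placeRow-other (suc r) ys []      (suc (suc s)) ne = row-placeRow-other r ys [] (suc s) (ne ∘ cong suc)
row-placeRow-other (suc r) ys (_ ∷ X) (suc (suc s)) ne = row-placeRow-other r ys X (suc s) (ne ∘ cong suc)

placeRow-NoTrailingEmptyRow : ∀ r ys X → ys ≢ [] → NoTrailingEmptyRow X →
                              NoTrailingEmptyRow (placeRow (suc r) ys X)
placeRow-NoTrailingEmptyRow zero    ys []          ne n = ne ∘ just-injective
placeRow-NoTrailingEmptyRow zero    ys (_ ∷ [])    ne n = ne ∘ just-injective
placeRow-NoTrailingEmptyRow zero    ys (_ ∷ _ ∷ X) ne n = n
placeRow-NoTrailingEmptyRow (suc r) ys []          ne n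
  with placeRow (suc r) ys [] in eq
     | placeRow-NoTrailingEmptyRow r ys [] ne n
... | _ ∷ _ | n′ = n′
... | []    | _  = λ _ → ne (trans (sym (row-placeRow-same r ys [])) (cong (λ X → row X (suc r)) eq))
placeRow-NoTrailingEmptyRow (suc r) ys (R ∷ [])    ne n
  with placeRow (suc r) ys [] in eq
     | placeRow-NoTrailingEmptyRow r ys [] ne (λ ())
... | _ ∷ _ | n′ = n′
... | []    | _  = λ _ → ne (trans (sym (row-placeRow-same r ys [])) (cong (λ X → row X (suc r)) eq))
placeRow-NoTrailingEmptyRow (suc r) ys (R ∷ S ∷ X) ne n
  with placeRow (suc r) ys (S ∷ X) in eq
     | placeRow-NoTrailingEmptyRow r ys (S ∷ X) ne n
... | _ ∷ _ | n′ = n′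
... | []    | _  = λ _ → ne (trans (sym (row-placeRow-same r ys (S ∷ X))) (cong (λ X → row X (suc r)) eq))

‼-head : ∀ xs → xs ‼ c ≡ just v → ∃[ h ] xs ‼ 1 ≡ just h
‼-head (x ∷ xs) eq = x , refl

-- Distinct heads ensure that no row overwrites another, and positive heads that no row is lost to
-- the clause of `placeRow` for row 0.
module Placing {L : List (List ℕ)}
  (heads-distinct : AllPairs (Cellwise _≢_ 1) L) (positive : All (All (0 <_)) L) where

  row-placeAll⁺ : R ∈ L → R ‼ 1 ≡ just r → row (placeAll L) r ≡ R
  row-placeAll⁺ = go heads-distinct positive
    where
    go : ∀ {L R r} → AllPairs (Cellwise _≢_ 1) L → All (All (0 <_)) L →
         R ∈ L → R ‼ 1 ≡ just r → row (placeAll L) r ≡ R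
    go {(suc y ∷ ys) ∷ L} (d ∷ ds) (p ∷ ps) (here refl) refl = row-placeRow-same y (suc y ∷ ys) (placeAll L)
    go {[] ∷ L}           (d ∷ ds) (p ∷ ps) (here refl) ()
    go {[] ∷ L}           (d ∷ ds) (p ∷ ps) (there R∈)  eq   = go ds ps R∈ eq
    go {(suc y ∷ ys) ∷ L} (d ∷ ds) (p ∷ ps) (there R∈)  eq   =
      trans (row-placeRow-other y (suc y ∷ ys) (placeAll L) _ (≢-sym (All.lookup d R∈ _ _ refl eq))) (go ds ps R∈ eq)
    go {(zero ∷ ys) ∷ L}  (d ∷ ds) ((() ∷ _) ∷ ps)

  row-placeAll⁻ : ∀ r → row (placeAll L) r ≡ [] ⊎ (row (placeAll L) r ∈ L × row (placeAll L) r ‼ 1 ≡ just r)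
  row-placeAll⁻ r = go positive
    where
    go : ∀ {L} → All (All (0 <_)) L →
         row (placeAll L) r ≡ [] ⊎ (row (placeAll L) r ∈ L × row (placeAll L) r ‼ 1 ≡ just r)
    go {[]}     ps       = inj₁ refl
    go {[] ∷ L} (p ∷ ps) with go ps
    ... | inj₁ eq         = inj₁ eq
    ... | inj₂ (R∈ , eq)  = inj₂ (there R∈ , eq)
    go {(zero ∷ ys) ∷ L} ((() ∷ _) ∷ ps)
    go {(suc y ∷ ys) ∷ L} (p ∷ ps) with r ≟ suc y
    ... | yes refl rewrite row-placeRow-same y (suc y ∷ ys) (placeAll L) = inj₂ (here refl , refl)
    ... | no  ne rewrite row-placeRow-other y (suc y ∷ ys) (placeAll L) r ne with go ps
    ... | inj₁ eq        = inj₁ eq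
    ... | inj₂ (R∈ , eq) = inj₂ (there R∈ , eq)

  cell-placeAll : ∀ r → cell (placeAll L) r c ≡ just v → row (placeAll L) r ∈ L × row (placeAll L) r ‼ 1 ≡ just r
  cell-placeAll {c} r eq with row-placeAll⁻ r
  ... | inj₁ empty = contradiction (cong (_‼ c) empty) (just≢nothing eq)
  ... | inj₂ p     = p

  placeAll-NoTrailingEmptyRow : NoTrailingEmptyRow (placeAll L)
  placeAll-NoTrailingEmptyRow = go positive
    where
    go : ∀ {L} → All (All (0 <_)) L → NoTrailingEmptyRow (placeAll L)
    go {[]} [] ()
    go {[] ∷ L} (p ∷ ps) = go ps
    go {(zero ∷ ys) ∷ L} ((() ∷ _) ∷ ps)
    go {(suc y ∷ ys) ∷ L} (p ∷ ps) = placeRow-NoTrailingEmptyRow y (suc y ∷ ys) (placeAll L) (λ ()) (go ps)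

  placeAll-≈ᶜ : placeAll L ≈ᶜ L
  placeAll-≈ᶜ = mutual-⊆ᶜ to from
    where
    to : placeAll L ⊆ᶜ L
    to (r , eq) = let R∈ , _ = cell-placeAll r eq ; s , row≡ = ∈⇒row R∈ in suc s , trans (cong (_‼ _) row≡) eq
    from : L ⊆ᶜ placeAll L
    from (r , eq) = let h , eq′ = ‼-head (row L r) eq in
      h , trans (cong (_‼ _) (row-placeAll⁺ (cell⇒∈ L eq) eq′)) eq

  placeAll-first-column : FirstColumnIsRowIndex (placeAll L)
  placeAll-first-column {r} eq = let _ , eq′ = cell-placeAll r eq in just-injective (trans (sym eq) eq′)

decreasing-head : Linked _≥_ R → R ‼ 1 ≡ just w → R ‼ c ≡ just v → v ≤ w
decreasing-head {c = suc zero}    l eq eq′ = ≤-reflexive (just-injective (trans (sym eq′) eq))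
decreasing-head {c = suc (suc c)} l eq eq′ =
  let u , eq″ , v≤u = decreasing-pred l eq′ in ≤-trans v≤u (decreasing-head {c = suc c} l eq eq″)
decreasing-head {R = []}    {c = zero} l eq ()
decreasing-head {R = _ ∷ _} {c = zero} l eq ()

-- Quasi-key tableaux

-- ψ prefers R to S: in every column, the entry of R is the least admissible one given the next
-- entry z of R, even with the entries of S still available.
record Beats (R S : List ℕ) : Set where
  constructor beats
  field beat : ∀ c v → S ‼ c ≡ just v →
               ∃[ w ] R ‼ c ≡ just w × (w < v ⊎ ∃[ z ] R ‼ suc c ≡ just z × v < z)
open Beats

-- A common entry is not smaller than itself, and not smaller than its right neighbour in the
-- decreasing row `R`.
Beats⇒distinct : ∀ c → Linked _≥_ R → Beats R S → Cellwise _≢_ c R S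
Beats⇒distinct c l b v w eq eq′ refl with beat b c v eq′
... | u , eq″ , inj₁ u<v = <⇒≢ u<v (just-injective (trans (sym eq″) eq))
... | u , eq″ , inj₂ (z , eqz , v<z) = <⇒≱ v<z (Linked⇒pair l eq eqz)

Beats⇒length : Beats R S → length R ≥ length S
Beats⇒length {R} {S} b = ≮⇒≥ λ R<S →
  let _ , eq = <length⇒‼-just S R<S ; _ , eq′ , _ = beat b _ _ eq
  in contradiction (‼-just⇒≤length R eq′) 1+n≰n

-- The alternative `w < v` fails in every column. In the first it contradicts the heads. Further
-- right, the preceding column gives `u < w` for the left neighbour `u ≥ v` of `v`.
Beats⇒ahead : Beats R S → Linked _≥_ S → R ‼ 1 ≡ just r → S ‼ 1 ≡ just s → s < r →
              ∀ c v → S ‼ c ≡ just v → ∃[ z ] R ‼ suc c ≡ just z × v < z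
Beats⇒ahead {R} {S} {r} {s} b l eqr eqs s<r = λ
  { zero    v eq → contradiction (‼-zero S) (just≢nothing eq)
  ; (suc c) v eq → ahead c v eq }
  where
  ahead : ∀ c v → S ‼ suc c ≡ just v → ∃[ z ] R ‼ suc (suc c) ≡ just z × v < z
  ahead c v eq with beat b (suc c) v eq
  ahead c       v eq | w , eqw , inj₂ p = p
  ahead zero    v eq | w , eqw , inj₁ w<v with refl ← trans (sym eqs) eq | refl ← trans (sym eqr) eqw =
    contradiction s<r (<-asym w<v)
  ahead (suc c) v eq | w , eqw , inj₁ w<v =
    let u , equ , v≤u = decreasing-pred l eq
        z , eqz , u<z = ahead c u equ
    in contradiction (subst (u <_) (just-injective (trans (sym eqz) eqw)) u<z) (≤⇒≯ (≤-trans (<⇒≤ w<v) v≤u))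

-- From an order of extraction to a quasi-key tableau

AllPairs-All : {P : A → Set} {Q : A → A → Set} {xs : List A} → All P xs → AllPairs Q xs →
               AllPairs (λ x y → P x × P y × Q x y) xs
AllPairs-All []       []       = []
AllPairs-All (p ∷ ps) (q ∷ qs) = All.zipWith (λ (p′ , q′) → p , p′ , q′) (ps , q) ∷ AllPairs-All ps qs

AllPairs-∈ : {P : A → A → Set} {xs : List A} {a b : A} → AllPairs P xs → a ∈ xs → b ∈ xs →
             a ≡ b ⊎ P a b ⊎ P b a
AllPairs-∈ (p ∷ ps) (here refl) (here refl) = inj₁ refl
AllPairs-∈ (p ∷ ps) (here refl) (there b∈)  = inj₂ (inj₁ (All.lookup p b∈))
AllPairs-∈ (p ∷ ps) (there a∈)  (here refl) = inj₂ (inj₂ (All.lookup p a∈))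
AllPairs-∈ (p ∷ ps) (there a∈)  (there b∈)  = AllPairs-∈ ps a∈ b∈

-- Each row beats all later ones, not just the next, because `ψ` chooses it while all their entries
-- are available. Lengths are not mentioned: `Beats` forces them to decrease weakly.
record RowOrder (L : List (List ℕ)) : Set where
  field
    rows-nonempty  : All (_≢ []) L
    rows-positive  : All (All (0 <_)) L
    rows-decrease  : All (Linked _≥_) L
    rows-beat      : AllPairs Beats L

  distinct : ∀ c → AllPairs (Cellwise _≢_ c) L
  distinct c = AllPairs.map (λ (l , _ , b) → Beats⇒distinct c l b) (AllPairs-All rows-decrease rows-beat)

module FromRowOrder {L : List (List ℕ)} (rowOrder : RowOrder L) where
  open RowOrder rowOrder
  open Placing (distinct 1) rows-positive public

  -- Tells which of the two rows comes first in `L`. If it is the upper one, its head is the larger,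
  -- and `Beats⇒ahead` sharpens the relation.
  data Comparison (r s : ℕ) : Set where
    lower-beats : Beats (row (placeAll L) r) (row (placeAll L) s) → Comparison r s
    upper-beats : Beats (row (placeAll L) s) (row (placeAll L) r) →
                  (∀ c v → cell (placeAll L) r c ≡ just v → ∃[ z ] cell (placeAll L) s (suc c) ≡ just z × v < z) →
                  Comparison r s

  row-decreasing : cell (placeAll L) r c ≡ just v → Linked _≥_ (row (placeAll L) r)
  row-decreasing {r} eq = All.lookup rows-decrease (proj₁ (cell-placeAll r eq))

  compare-rows : r < s → cell (placeAll L) r c ≡ just v → cell (placeAll L) s d ≡ just w → Comparison r s
  compare-rows {r} {s} r<s eq eq′ with cell-placeAll r eq | cell-placeAll s eq′
  ... | R∈ , headr | S∈ , heads with AllPairs-∈ rows-beat R∈ S∈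
  ... | inj₁ R≡S      = contradiction
    (just-injective (trans (sym headr) (trans (cong (_‼ 1) R≡S) heads))) (<⇒≢ r<s)
  ... | inj₂ (inj₁ b) = lower-beats b
  ... | inj₂ (inj₂ b) = upper-beats b (Beats⇒ahead b (All.lookup rows-decrease R∈) heads headr r<s)

  -- If the lower row comes first, `beat` yields the inversion condition, and the upper row cannot
  -- be longer. If the upper row comes first, `ahead` is the condition for longer upper rows, and an
  -- inversion `i < k` would give `i < k < z` with `z` immediately right of `i`.
  placeAll-QKT¹ : QKT¹ (placeAll L)
  placeAll-QKT¹ = record
    { quasiKey = record
      { composition-shape = placeAll-NoTrailingEmptyRow
      ; positive          = row⇒All λ r → row-property (All (0 <_)) [] rows-positive r
      ; rows-decrease     = row⇒All λ r → row-property (Linked _≥_) [] rows-decrease r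
      ; flagged           = λ {r} {c} eq →
          decreasing-head (row-decreasing {r} {c} eq) (proj₂ (cell-placeAll r eq)) eq
      ; columns-distinct  = columns-distinct
      ; first-increasing  = λ r<s eq eq′ →
          subst₂ _<_ (sym (placeAll-first-column eq)) (sym (placeAll-first-column eq′)) r<s
      ; inversion-right   = inversion-right
      ; longer-above      = longer-above
      }
    ; first-column = placeAll-first-column
    }
    where
    row-property : (P : List ℕ → Set) → P [] → All P L → ∀ r → P (row (placeAll L) r)
    row-property P p ps r with row-placeAll⁻ r
    ... | inj₁ eq       = subst P (sym eq) p
    ... | inj₂ (R∈ , _) = All.lookup ps R∈

    columns-distinct : ColumnsDistinct (placeAll L)
    columns-distinct {r} {s} {c} r<s eq eq′ with compare-rows {r} {s} r<s eq eq′
    ... | lower-beats b   = Beats⇒distinct c (row-decreasing {r} {c} eq) b _ _ eq eq′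
    ... | upper-beats b _ = ≢-sym (Beats⇒distinct c (row-decreasing {s} {c} eq′) b _ _ eq′ eq)

    inversion-right : ∀ {r s c i k} → r < s → cell (placeAll L) s c ≡ just i → cell (placeAll L) r c ≡ just k →
                      i < k → ∃[ j ] cell (placeAll L) r (suc c) ≡ just j × i < j
    inversion-right {r} {s} {c} {i} {k} r<s eqi eqk i<k with compare-rows {r} {s} r<s eqk eqi
    ... | lower-beats b with beat b c i eqi
    ...   | w , eqw , inj₂ p   = p
    ...   | w , eqw , inj₁ w<i = contradiction (subst (_< i) (just-injective (trans (sym eqw) eqk)) w<i) (<-asym i<k)
    inversion-right {r} {s} {c} {i} {k} r<s eqi eqk i<k | upper-beats b ahead =
      let z , eqz , k<z = ahead c k eqk
      in contradiction (Linked⇒pair (row-decreasing {s} {c} eqi) eqi eqz) (<⇒≱ (<-trans i<k k<z))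

    longer-above : ∀ {r s c i j} → r < s → rowLength (placeAll L) r < rowLength (placeAll L) s →
                   cell (placeAll L) r c ≡ just i → cell (placeAll L) s (suc c) ≡ just j → i < j
    longer-above {r} {s} {c} {i} {j} r<s len eqi eqj with compare-rows {r} {s} r<s eqi eqj
    ... | lower-beats b = contradiction (Beats⇒length b) (<⇒≱ len)
    ... | upper-beats b ahead =
      let z , eqz , i<z = ahead c i eqi in subst (i <_) (just-injective (trans (sym eqz) eqj)) i<z

-- Uniqueness of the order of extraction

module _ {R S : List ℕ} {L M : List (List ℕ)} (oL : RowOrder (R ∷ L)) (oM : RowOrder (S ∷ M))
         (L⊆M : R ∷ L ⊆ᶜ S ∷ M) (M⊆L : S ∷ M ⊆ᶜ R ∷ L) where

  -- If `v` lies in a later row of `S ∷ M`, then `S` beats that row. Its entry `z` in the next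
  -- column is shared with `R`, so `v < z` is impossible, and `S` has some `w < v`. This `w` lies in
  -- a later row of `R ∷ L`, and `R` would have to beat that row with `v`, although `v > w` and `w`
  -- is not below the shared next entry.
  first-row-step : ∀ c v → R ‼ suc c ≡ S ‼ suc c → R ‼ c ≡ just v → S ‼ c ≡ just v
  first-row-step c v next eq with occurs⇒any (S ∷ M) (L⊆M {c} {v} (1 , eq))
  ... | here eq′ = eq′
  ... | there p with find p | RowOrder.rows-beat oM | RowOrder.rows-decrease oM
                           | RowOrder.rows-beat oL | RowOrder.rows-decrease oL
  ... | S′ , S′∈ , eq′ | bM ∷ _ | lS ∷ _ | bL ∷ _ | lR ∷ _ with beat (All.lookup bM S′∈) c v eq′
  ... | w , eqw , inj₂ (z , eqz , v<z) = contradiction (Linked⇒pair lR eq (trans next eqz)) (<⇒≱ v<z)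
  ... | w , eqw , inj₁ w<v with occurs⇒any (R ∷ L) (M⊆L {c} {w} (1 , eqw))
  ...   | here eq″ = contradiction (just-injective (trans (sym eq″) eq)) (<⇒≢ w<v)
  ...   | there q with find q
  ...     | R′ , R′∈ , eq″ with beat (All.lookup bL R′∈) c w eq″
  ...       | u , equ , inj₁ u<w = contradiction (subst (_< w) (just-injective (trans (sym equ) eq)) u<w) (<-asym w<v)
  ...       | u , equ , inj₂ (z , eqz , w<z) = contradiction (Linked⇒pair lS eqw (trans (sym next) eqz)) (<⇒≱ w<z)

-- The rows are compared from right to left, the direction in which `ψ` chooses entries. The
-- induction of `agree` starts beyond both ends, with `n` bounding the columns still to the right of
-- `c`.
first-row-≡ : ∀ {R S L M} → RowOrder (R ∷ L) → RowOrder (S ∷ M) → R ∷ L ≈ᶜ S ∷ M → R ≡ S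
first-row-≡ {R} {S} {L} {M} oL oM (mutual-⊆ᶜ L⊆M M⊆L) = ‼-ext λ
  { zero    → trans (‼-zero R) (sym (‼-zero S))
  ; (suc c) → agree (length R ⊔ length S) c
      (m≤n⇒m≤o+n c (m≤m⊔n (length R) (length S))) (m≤n⇒m≤o+n c (m≤n⊔m (length R) (length S))) }
  where
  agree : ∀ n c → length R ≤ c + n → length S ≤ c + n → R ‼ suc c ≡ S ‼ suc c
  agree zero c R≤ S≤ rewrite +-identityʳ c =
    trans (length≤⇒‼-nothing R R≤) (sym (length≤⇒‼-nothing S S≤))
  agree (suc n) c R≤ S≤
    with agree n (suc c) (subst (length R ≤_) (+-suc c n) R≤) (subst (length S ≤_) (+-suc c n) S≤)
       | R ‼ suc c in eqR | S ‼ suc c in eqS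
  ... | next | just v  | _       = trans (sym (first-row-step oL oM L⊆M M⊆L (suc c) v next eqR)) eqS
  ... | next | nothing | just w  = trans (sym eqR) (first-row-step oM oL M⊆L L⊆M (suc c) w (sym next) eqS)
  ... | next | nothing | nothing = refl

RowOrder-tail : ∀ {R L} → RowOrder (R ∷ L) → RowOrder L
RowOrder-tail o = record
  { rows-nonempty = All.tail rows-nonempty
  ; rows-positive = All.tail rows-positive
  ; rows-decrease = All.tail rows-decrease
  ; rows-beat     = AllPairs.tail rows-beat
  }
  where open RowOrder o

-- An entry of `L` found in the common first row `R` would occur twice in its column of `R ∷ L`.
tail-⊆ᶜ : ∀ {R L M} → RowOrder (R ∷ L) → R ∷ L ⊆ᶜ R ∷ M → L ⊆ᶜ M
tail-⊆ᶜ {R} {L} {M} o L⊆M {c} {v} occ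
  with occurs⇒any L occ
... | p with occurs⇒any (R ∷ M) (L⊆M (let r , eq = any⇒occurs p in suc (suc r) , eq))
... | there q = let r , eq = any⇒occurs q in suc r , eq
... | here eq with find p | RowOrder.distinct o c
... | R′ , R′∈ , eq′ | d ∷ _ = contradiction refl (All.lookup d R′∈ v v eq eq′)

-- Empty rows leave no trace in the column sets; `rows-nonempty` excludes a remainder made of them.
RowOrder-unique : ∀ {L M} → RowOrder L → RowOrder M → L ≈ᶜ M → L ≡ M
RowOrder-unique {[]}    {[]}    oL oM eq = refl
RowOrder-unique {[]}    {[] ∷ M} oL oM eq = contradiction refl (All.head (RowOrder.rows-nonempty oM))
RowOrder-unique {[]}    {(x ∷ S) ∷ M} oL oM (mutual-⊆ᶜ _ M⊆L) with () ← proj₂ (M⊆L {1} {x} (1 , refl))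
RowOrder-unique {[] ∷ L} {[]} oL oM eq = contradiction refl (All.head (RowOrder.rows-nonempty oL))
RowOrder-unique {(x ∷ R) ∷ L} {[]} oL oM (mutual-⊆ᶜ L⊆M _) with () ← proj₂ (L⊆M {1} {x} (1 , refl))
RowOrder-unique {R ∷ L} {S ∷ M} oL oM (mutual-⊆ᶜ L⊆M M⊆L) with refl ← first-row-≡ oL oM (mutual-⊆ᶜ L⊆M M⊆L) =
  cong (R ∷_) (RowOrder-unique (RowOrder-tail oL) (RowOrder-tail oM)
                          (mutual-⊆ᶜ (tail-⊆ᶜ oL L⊆M) (tail-⊆ᶜ oM M⊆L)))

-- Recovering the order of the rows

priorityOrder : DecTotalOrder _ _ _
priorityOrder = On.decTotalOrder (×-decTotalOrder (Flip.decTotalOrder ≤-decTotalOrder) ≤-decTotalOrder)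
                                 (λ R → length R , fromMaybe 0 (R ‼ 1))

open DecTotalOrder priorityOrder using () renaming (_≤_ to _≼_; trans to ≼-trans)
open module SortRows = Sort priorityOrder
  using () renaming (sort to sortRows; sort-↭ to sortRows-↭; sort-↗ to sortRows-≼)

≼⇒longer : ∀ R S → R ‼ 1 ≡ just r → S ‼ 1 ≡ just s → R ≼ S →
           length S < length R ⊎ (length S ≤ length R × r ≤ s)
≼⇒longer R S eqr eqs (inj₁ (S≤R , R≢S)) = inj₁ (≤∧≢⇒< S≤R λ eq → R≢S (sym eq))
≼⇒longer R S eqr eqs (inj₂ (R≡S , r≤s)) rewrite eqr | eqs = inj₂ (≤-reflexive (sym R≡S) , r≤s)

module _ {X : Filling} (qkt : QKT¹ X) where
  open QKT¹ qkt
  open QuasiKey quasiKey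

  -- If `r` is the upper row, it comes first only by being strictly longer, and `longer-above` gives
  -- the second alternative throughout. If it is the lower row, an entry `w > v` is an inversion,
  -- and `inversion-right` gives that alternative.
  ≼⇒Beats : r ≢ s → row X r ‼ 1 ≡ just r → row X s ‼ 1 ≡ just s → row X r ≼ row X s →
            Beats (row X r) (row X s)
  ≼⇒Beats {r} {s} r≢s eqr eqs R≼S = beats λ c v eq → beat′ c v eq (at c v eq)
    where
    S≤R : length (row X s) ≤ length (row X r)
    S≤R with ≼⇒longer (row X r) (row X s) eqr eqs R≼S
    ... | inj₁ S<R       = <⇒≤ S<R
    ... | inj₂ (S≤R , _) = S≤R

    at : ∀ c v → row X s ‼ c ≡ just v → ∃[ w ] row X r ‼ c ≡ just w
    at c v eq with ‼-index {c = c} (row X s) eq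
    ... | d , refl = <length⇒‼-just (row X r) (≤-trans (‼-just⇒≤length (row X s) eq) S≤R)

    beat′ : ∀ c v → row X s ‼ c ≡ just v → ∃[ w ] row X r ‼ c ≡ just w →
            ∃[ w ] row X r ‼ c ≡ just w × (w < v ⊎ ∃[ z ] row X r ‼ suc c ≡ just z × v < z)
    beat′ c v eq (w , eqw) with <-cmp r s | ≼⇒longer (row X r) (row X s) eqr eqs R≼S
    ... | tri≈ _ r≡s _ | _ = contradiction r≡s r≢s
    ... | tri> _ _ s<r | inj₂ (_ , r≤s) = contradiction s<r (≤⇒≯ r≤s)
    ... | tri> _ _ s<r | inj₁ S<R =
      let z , eqz = <length⇒‼-just (row X r) (≤-trans (s≤s (‼-just⇒≤length (row X s) eq)) S<R)
      in w , eqw , inj₂ (z , eqz , longer-above s<r S<R eq eqz)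
    ... | tri< r<s _ _ | _ with <-cmp w v
    ...   | tri< w<v _ _ = w , eqw , inj₁ w<v
    ...   | tri≈ _ w≡v _ = contradiction w≡v (columns-distinct {r} {s} {c} r<s eqw eq)
    ...   | tri> _ _ v<w = w , eqw , inj₂ (inversion-right {r} {s} {c} r<s eq eqw v<w)

  -- Sorting forgets the position of a row, but its head is its index, so placing it by its head
  -- puts it back.
  QKT¹⇒placeAll : ∃[ L ] RowOrder L × X ≡ placeAll L
  QKT¹⇒placeAll = L , rowOrder , row-ext composition-shape placeAll-NoTrailingEmptyRow rows-agree
    where
    nonempty? = λ (R : List ℕ) → 0 <? length R
    L = sortRows (filter nonempty? X)

    IsRow : List ℕ → Set
    IsRow R = ∃[ r ] row X r ≡ R × R ‼ 1 ≡ just r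

    L⊆X : R ∈ L → R ∈ X × 0 < length R
    L⊆X R∈ = ∈-filter⁻ nonempty? {xs = X} (∈-resp-↭ (sortRows-↭ _) R∈)

    X⊆L : ∀ r → cell X r c ≡ just v → row X r ∈ L
    X⊆L {c} r eq = ∈-resp-↭ (↭-sym (sortRows-↭ _)) (∈-filter⁺ nonempty? (cell⇒∈ X eq)
      (let _ , eq′ = ‼-head (row X r) eq in ‼-just⇒≤length (row X r) eq′))

    isRow : All IsRow L
    isRow = All.tabulate λ {R} R∈ →
      let R∈X , 0<R = L⊆X R∈ ; r , row≡ = ∈⇒row R∈X ; v , eq = <length⇒‼-just R 0<R
      in suc r , row≡ , trans eq (cong just (first-column (trans (cong (_‼ 1) row≡) eq)))

    heads-distinct : AllPairs (Cellwise _≢_ 1) L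
    heads-distinct = AllPairs-resp-↭ (λ p _ _ eq eq′ → ≢-sym (p _ _ eq′ eq)) (↭-sym (sortRows-↭ _))
      (AllPairs.filter⁺ nonempty? (cells⇒AllPairs X λ {r} {s} → columns-distinct {r} {s} {1}))

    row-beats : ∀ {R S} → IsRow R × IsRow S × (R ≼ S × Cellwise _≢_ 1 R S) → Beats R S
    row-beats ((r , refl , eqr) , (s , refl , eqs) , R≼S , ne) = ≼⇒Beats (ne _ _ eqr eqs) eqr eqs R≼S

    rowOrder : RowOrder L
    rowOrder = record
      { rows-nonempty = All.tabulate λ R∈ R≡[] → <⇒≢ (proj₂ (L⊆X R∈)) (sym (cong length R≡[]))
      ; rows-positive = All.tabulate λ R∈ → All.lookup positive (proj₁ (L⊆X R∈))
      ; rows-decrease = All.tabulate λ R∈ → All.lookup rows-decrease (proj₁ (L⊆X R∈))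
      ; rows-beat     = AllPairs.map row-beats (AllPairs-All isRow
          (AllPairs.zip (Linked⇒AllPairs (λ {i} {j} {k} → ≼-trans {i} {j} {k}) (sortRows-≼ _) , heads-distinct)))
      }

    open FromRowOrder rowOrder

    rows-agree : ∀ r → row X r ≡ row (placeAll L) r
    rows-agree r with row X r in eq
    ... | y ∷ ys = sym (row-placeAll⁺ (subst (_∈ L) eq (X⊆L {1} r (cong (_‼ 1) eq)))
                                      (cong just (first-column (cong (_‼ 1) eq))))
    ... | [] with row-placeAll⁻ r
    ...   | inj₁ eq′ = sym eq′
    ...   | inj₂ (R∈ , head) with All.lookup isRow R∈
    ...     | s , row≡ , head′ with refl ← trans (sym head) head′ = trans (sym eq) row≡

QKT¹-unique : QKT¹ X → QKT¹ Y → X ≈ᶜ Y → X ≡ Y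
QKT¹-unique qX qY X≈Y with QKT¹⇒placeAll qX | QKT¹⇒placeAll qY
... | L , oL , refl | M , oM , refl = cong placeAll (RowOrder-unique oL oM
  (≈ᶜ-trans (≈ᶜ-sym (FromRowOrder.placeAll-≈ᶜ oL)) (≈ᶜ-trans X≈Y (FromRowOrder.placeAll-≈ᶜ oM))))

-- Row-filling

-- Specifies `nextRow`. By `done` and `final`, a row ends only where all columns further right are
-- empty, so no remaining entry lies beyond its end.
data Greedy : List ℕ → List (List ℕ) → Set where
  done : ∀ {Cs} → All (_≡ []) Cs → Greedy [] Cs
  final : ∀ {y C Cs} → y ∈ C → (∀ {x} → x ∈ C → y ≤ x) → All (_≡ []) Cs → Greedy (y ∷ []) (C ∷ Cs)
  step : ∀ {y z zs C Cs} → y ∈ C → z ≤ y → (∀ {x} → x ∈ C → z ≤ x → y ≤ x) →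
         Greedy (z ∷ zs) Cs → Greedy (y ∷ z ∷ zs) (C ∷ Cs)

smallest≥-just : ∀ b C {y} → smallest≥ b C ≡ just y →
                 y ∈ C × b ≤ y × (∀ {x} → x ∈ C → b ≤ x → y ≤ x)
smallest≥-just b C eq with filter (b ≤?_) C in eqf
smallest≥-just b C refl | y ∷ ys = proj₁ min∈ , proj₂ min∈ , least
  where
  min∈′ : Extrema.min y ys ∈ y ∷ ys
  min∈′ with Extrema.argmin-sel id y ys
  ... | inj₁ eq = here eq
  ... | inj₂ ∈  = there ∈
  min∈ : Extrema.min y ys ∈ C × b ≤ Extrema.min y ys
  min∈ = ∈-filter⁻ (b ≤?_) {xs = C} (subst (_ ∈_) (sym eqf) min∈′)
  least : ∀ {x} → x ∈ C → b ≤ x → Extrema.min y ys ≤ x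
  least x∈ b≤x with subst (_ ∈_) eqf (∈-filter⁺ (b ≤?_) x∈ b≤x)
  ... | here refl = Extrema.min≤⊤ y ys
  ... | there x∈′ = All.lookup (Extrema.min≤xs y ys) x∈′

smallest≥-nothing : ∀ b C → smallest≥ b C ≡ nothing → ∀ {x} → x ∈ C → ¬ b ≤ x
smallest≥-nothing b C eq x∈ b≤x with filter (b ≤?_) C | ∈-filter⁺ (b ≤?_) x∈ b≤x
smallest≥-nothing b C () x∈ b≤x | _ ∷ _ | _
smallest≥-nothing b C eq x∈ b≤x | [] | ()

Greedy-head∈ : ∀ {y ys C Cs} → Greedy (y ∷ ys) (C ∷ Cs) → y ∈ C
Greedy-head∈ (final y∈ _ _)   = y∈
Greedy-head∈ (step y∈ _ _ _) = y∈

-- Since `z` was taken from the next column `D`, `C ≽ D` provides an entry of `C` that is at least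
-- `z`. This rules out the fallback of `extendRow`, which would shift the row one column to the
-- left.
nextRow-Greedy : ∀ {Cs} → Linked _≽_ Cs → Greedy (nextRow Cs) Cs
nextRow-Greedy {[]}     ge = done []
nextRow-Greedy {C ∷ Cs} ge with nextRow Cs | nextRow-Greedy (Linked.tail ge)
... | [] | done empty with smallest≥ 0 C in eq
...   | nothing = done (all-empty C (smallest≥-nothing 0 C eq) ∷ empty)
  where
  all-empty : ∀ C → (∀ {x} → x ∈ C → ¬ 0 ≤ x) → C ≡ []
  all-empty []      _    = refl
  all-empty (x ∷ C) none = contradiction z≤n (none (here refl))
...   | just y  = let y∈ , _ , least = smallest≥-just 0 C eq in final y∈ (λ x∈ → least x∈ z≤n) empty
nextRow-Greedy {C ∷ D ∷ Cs} (C≽D ∷ ge) | z ∷ zs | g with smallest≥ z C in eq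
...   | just y  = let y∈ , z≤y , least = smallest≥-just z C eq in step y∈ z≤y least g
...   | nothing = let x , x∈ , z≤x = ≽-∈ {C} {D} C≽D (Greedy-head∈ g)
                  in contradiction z≤x (smallest≥-nothing z C eq x∈)

Greedy-decreasing : ∀ {ys Cs} → Greedy ys Cs → Linked _≥_ ys
Greedy-decreasing (done _)         = []
Greedy-decreasing (final _ _ _)     = [-]
Greedy-decreasing (step _ z≤y _ g) = z≤y ∷ Greedy-decreasing g

Greedy-∈ : ∀ {ys Cs} c → Greedy ys Cs → ys ‼ c ≡ just v → v ∈ row Cs c
Greedy-∈ (suc zero)    (final y∈ _ _)   refl = y∈
Greedy-∈ (suc zero)    (step y∈ _ _ _) refl = y∈
Greedy-∈ (suc (suc c)) (step _ _ _ g)  eq   = Greedy-∈ (suc c) g eq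
Greedy-∈ zero          (done _) ()
Greedy-∈ zero          (final _ _ _) ()
Greedy-∈ zero          (step _ _ _ _) ()

-- An available `x` is either admissible next to `z`, and then not below the chosen minimum, or it
-- is below `z`. Equality with the minimum disappears once the row is deleted, which gives `Beats`.
Greedy-beat : ∀ {ys Cs} c → Greedy ys Cs → x ∈ row Cs c →
              ∃[ w ] ys ‼ c ≡ just w × (w ≤ x ⊎ ∃[ z ] ys ‼ suc c ≡ just z × x < z)
Greedy-beat {Cs = Cs} zero g x∈ with () ← subst (_ ∈_) (row-zero Cs) x∈
Greedy-beat {x} (suc c) (done {Cs} empty) x∈ with () ← subst (_ ∈_) (All⇒row refl empty (suc c)) x∈
Greedy-beat (suc zero) (final {y} _ least _) x∈ = y , refl , inj₁ (least x∈)
Greedy-beat (suc (suc c)) (final _ _ empty) x∈ with () ← subst (_ ∈_) (All⇒row refl empty (suc c)) x∈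
Greedy-beat {x} (suc zero) (step {y} {z} _ _ least _) x∈ with z ≤? x
... | yes z≤x = y , refl , inj₁ (least x∈ z≤x)
... | no  z≰x = y , refl , inj₂ (z , refl , ≰⇒> z≰x)
Greedy-beat (suc (suc c)) (step _ _ _ g) x∈ = Greedy-beat (suc c) g x∈

∈-deleteRow⁻ : ∀ ys Cs c → x ∈ row (deleteRow ys Cs) c → x ∈ row Cs c × ys ‼ c ≢ just x
∈-deleteRow⁻ []       Cs       c             x∈ = x∈ , λ ()
∈-deleteRow⁻ (y ∷ ys) (C ∷ Cs) (suc zero)    x∈ = let x∈′ , x≢y = ∈-delete⁻ C x∈ in x∈′ , λ { refl → x≢y refl }
∈-deleteRow⁻ (y ∷ ys) (C ∷ Cs) (suc (suc c)) x∈ = ∈-deleteRow⁻ ys Cs (suc c) x∈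

∈-deleteRow⁺ : ∀ ys Cs c → x ∈ row Cs c → ys ‼ c ≢ just x → x ∈ row (deleteRow ys Cs) c
∈-deleteRow⁺ []       Cs       c             x∈ ne = x∈
∈-deleteRow⁺ (y ∷ ys) (C ∷ Cs) (suc zero)    x∈ ne = ∈-delete⁺ x∈ λ { refl → ne refl }
∈-deleteRow⁺ (y ∷ ys) (C ∷ Cs) (suc (suc c)) x∈ ne = ∈-deleteRow⁺ ys Cs (suc c) x∈ ne

deleteRow-Unique : ∀ ys {Cs} → All Unique Cs → All Unique (deleteRow ys Cs)
deleteRow-Unique []       us       = us
deleteRow-Unique (y ∷ ys) []       = []
deleteRow-Unique (y ∷ ys) (u ∷ us) = AllPairs.filter⁺ _ u ∷ deleteRow-Unique ys us

-- No entry of C lies in [z , y), so deleting y from C costs nothing above z that deleting z does not.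
delete-≽ : ∀ {y z} → Unique C → Unique D → y ∈ C → z ∈ D → z ≤ y → (∀ {x} → x ∈ C → z ≤ x → y ≤ x) →
           C ≽ D → delete y C ≽ delete z D
delete-≽ {C} {D} {y} {z} uC uD y∈ z∈ z≤y least C≽D t with t ≤? z
... | yes t≤z = ≤-pred (subst₂ _≤_
  (trans (count≥-↭ (delete-↭ uD z∈)) (count≥-accept (delete z D) t≤z))
  (trans (count≥-↭ (delete-↭ uC y∈)) (count≥-accept (delete y C) (≤-trans t≤z z≤y))) (C≽D t))
... | no  t≰z with t ≤? y
...   | no  t≰y = subst₂ _≤_
  (trans (count≥-↭ (delete-↭ uD z∈)) (count≥-reject (delete z D) (≰⇒> t≰z)))
  (trans (count≥-↭ (delete-↭ uC y∈)) (count≥-reject (delete y C) (≰⇒> t≰y))) (C≽D t)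
...   | yes t≤y = ≤-trans (count≥-anti (delete z D) (<⇒≤ (≰⇒> t≰z))) (≤-trans z-case (≤-reflexive same))
  where
  count≥-anti : ∀ E {t u} → u ≤ t → count≥ t E ≤ count≥ u E
  count≥-anti []      u≤t = z≤n
  count≥-anti (x ∷ E) {t} {u} u≤t with t ≤? x | u ≤? x
  ... | yes t≤x | yes u≤x = subst₂ _≤_ (sym (count≥-accept E t≤x)) (sym (count≥-accept E u≤x)) (s≤s (count≥-anti E u≤t))
  ... | no  t≰x | no  u≰x = subst₂ _≤_ (sym (count≥-reject E (≰⇒> t≰x))) (sym (count≥-reject E (≰⇒> u≰x)))
                           (count≥-anti E u≤t)
  ... | no  t≰x | yes u≤x = subst₂ _≤_ (sym (count≥-reject E (≰⇒> t≰x))) (sym (count≥-accept E u≤x))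
                           (m≤n⇒m≤1+n (count≥-anti E u≤t))
  ... | yes t≤x | no  u≰x = contradiction (≤-trans u≤t t≤x) u≰x
  z-case : count≥ z (delete z D) ≤ count≥ z (delete y C)
  z-case = ≤-pred (subst₂ _≤_
    (trans (count≥-↭ (delete-↭ uD z∈)) (count≥-accept (delete z D) ≤-refl))
    (trans (count≥-↭ (delete-↭ uC y∈)) (count≥-accept (delete y C) z≤y)) (C≽D z))
  same : count≥ z (delete y C) ≡ count≥ t (delete y C)
  same = between (delete y C) λ x∈ z≤x → ≤-trans t≤y (least (proj₁ (∈-delete⁻ C x∈)) z≤x)
    where
    between : ∀ E → (∀ {x} → x ∈ E → z ≤ x → t ≤ x) → count≥ z E ≡ count≥ t E
    between []      _ = refl
    between (x ∷ E) f with z ≤? x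
    ... | yes z≤x = trans (count≥-accept E z≤x) (trans (cong suc (between E (f ∘ there)))
                      (sym (count≥-accept E (f (here refl) z≤x))))
    ... | no  z≰x = trans (count≥-reject E (≰⇒> z≰x)) (trans (between E (f ∘ there))
                      (sym (count≥-reject E (<-trans (≰⇒> z≰x) (≰⇒> t≰z)))))

deleteRow-≽ : ∀ {ys Cs} → Greedy ys Cs → All Unique Cs → Linked _≽_ Cs → Linked _≽_ (deleteRow ys Cs)
deleteRow-≽ (done _) us ge = ge
deleteRow-≽ (final {y} {C} {[]}    _ _ _) us ge = [-]
deleteRow-≽ (final {y} {C} {_ ∷ _} _ _ (refl ∷ _)) us (_ ∷ ge) = ≽[] (delete y C) ∷ ge
deleteRow-≽ (step {C = C} {D ∷ Cs} y∈ z≤y least g) (uC ∷ uD ∷ us) (C≽D ∷ ge) with deleteRow-≽ g (uD ∷ us) ge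
... | ge′ with g
... | final _ _ _   = delete-≽ uC uD y∈ (Greedy-head∈ g) z≤y least C≽D ∷ ge′
... | step _ _ _ _ = delete-≽ uC uD y∈ (Greedy-head∈ g) z≤y least C≽D ∷ ge′

-- The contents of `RowOrder` except for positivity, which arbitrary columns do not provide and the
-- tableau supplies afterwards.
Filled : List (List ℕ) → Filling → Set
Filled Cs X = ∃[ L ] X ≡ placeAll L × All (_≢ []) L × All (Linked _≥_) L × AllPairs Beats L ×
              (∀ {c v} → OccursIn L c v → v ∈ row Cs c) × (∀ {c v} → v ∈ row Cs c → OccursIn L c v)

empty⇒Filled : ∀ {Cs} → All (_≡ []) Cs → Filled Cs []
empty⇒Filled {Cs} empty = [] , refl , [] , [] , [] , (λ ()) ,
  λ {c} v∈ → none c (subst (_ ∈_) (All⇒row refl empty c) v∈)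
  where
  none : ∀ c {v} → v ∈ [] → OccursIn [] c v
  none c ()

-- The length of the first column already bounds the iterations: every extracted row takes one entry
-- from it, and by domination all columns are empty once it is.
rowFill-Filled : ∀ n {Cs} → Linked _≽_ Cs → All Unique Cs → length (row Cs 1) ≤ n → Filled Cs (rowFill n Cs)
rowFill-Filled zero {Cs} ge us len≤ = empty⇒Filled (all-empty Cs ge (length-0 (row Cs 1) len≤))
  where
  length-0 : ∀ (C : List ℕ) → length C ≤ 0 → C ≡ []
  length-0 [] _ = refl
  all-empty : ∀ Cs → Linked _≽_ Cs → row Cs 1 ≡ [] → All (_≡ []) Cs
  all-empty []           _         _    = []
  all-empty (C ∷ [])     _         eq   = eq ∷ []
  all-empty (.[] ∷ D ∷ Cs) (ge ∷ ges) refl = refl ∷ all-empty (D ∷ Cs) ges ([]≽⇒[] {D} ge)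
rowFill-Filled (suc n) {Cs} ge us len≤ with nextRow Cs | nextRow-Greedy ge
... | []     | done empty = empty⇒Filled empty
... | y ∷ ys | g with rowFill-Filled n (deleteRow-≽ g us ge) (deleteRow-Unique (y ∷ ys) us) (shorter g us len≤)
  where
  shorter : ∀ {Cs} → Greedy (y ∷ ys) Cs → All Unique Cs → length (row Cs 1) ≤ suc n →
            length (row (deleteRow (y ∷ ys) Cs) 1) ≤ n
  shorter {C ∷ Cs} g (u ∷ us) len≤ = ≤-pred (subst (_≤ suc n) (↭-length (delete-↭ u (Greedy-head∈ g))) len≤)
... | L , eq , nonempty , decreasing , beating , L⊆ , ⊆L =
  (y ∷ ys) ∷ L , cong (placeRow y (y ∷ ys)) eq , (λ ()) ∷ nonempty , Greedy-decreasing g ∷ decreasing ,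
  All.tabulate (λ R∈ → beats (beats-rest R∈)) ∷ beating , to , from
  where
  beats-rest : ∀ {R} → R ∈ L → ∀ c v → R ‼ c ≡ just v →
               ∃[ w ] (y ∷ ys) ‼ c ≡ just w × (w < v ⊎ ∃[ z ] (y ∷ ys) ‼ suc c ≡ just z × v < z)
  beats-rest R∈ c v eqv with ∈⇒row R∈
  ... | r , row≡ with ∈-deleteRow⁻ (y ∷ ys) Cs c (L⊆ (suc r , trans (cong (_‼ c) row≡) eqv))
  ... | v∈ , ne with Greedy-beat c g v∈
  -- Equality would make `v` the entry just deleted from its column.
  ... | w , eqw , inj₁ w≤v = w , eqw , inj₁ (≤∧≢⇒< w≤v λ { refl → ne eqw })
  ... | w , eqw , inj₂ p   = w , eqw , inj₂ p
  to : ∀ {c v} → OccursIn ((y ∷ ys) ∷ L) c v → v ∈ row Cs c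
  to {c} occ with occurs⇒any ((y ∷ ys) ∷ L) occ
  ... | here eqv = Greedy-∈ c g eqv
  ... | there p  = let r , eqv = any⇒occurs p in proj₁ (∈-deleteRow⁻ (y ∷ ys) Cs c (L⊆ (suc r , eqv)))
  later : ∀ {c v} → OccursIn L c v → OccursIn ((y ∷ ys) ∷ L) c v
  later occ = let r , eqv = any⇒occurs (occurs⇒any L occ) in suc (suc r) , eqv
  from : ∀ {c v} → v ∈ row Cs c → OccursIn ((y ∷ ys) ∷ L) c v
  from {c} {v} v∈ with (y ∷ ys) ‼ c in eqw
  ... | nothing = later (⊆L (∈-deleteRow⁺ (y ∷ ys) Cs c v∈ λ eqv → just≢nothing eqv eqw))
  ... | just w with w ≟ v
  ...   | yes refl = 1 , eqw
  ...   | no  w≢v  = later (⊆L (∈-deleteRow⁺ (y ∷ ys) Cs c v∈ λ eqv → w≢v (just-injective (trans (sym eqw) eqv))))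

-- Images of reverse tableaux under `ψ`

module _ {V : Filling} (ssyt : RevSSYT V) where
  open RevSSYT ssyt

  RevSSYT-columns-distinct : ColumnsDistinct V
  RevSSYT-columns-distinct {c = c} r<s eq eq′ = >⇒≢ (columns-decrease {c = c} r<s eq eq′)

  columns-≽-Linked : Linked _≽_ (columns V)
  columns-≽-Linked = Linked.map⁺ (Linked.applyUpTo⁺₂ id (width V) λ c → columns-≽ V rows-decrease)

  ∈columns⇒occurs : ∀ c → v ∈ row (columns V) c → OccursIn V c v
  ∈columns⇒occurs zero    v∈ with () ← subst (_ ∈_) (row-zero (columns V)) v∈
  ∈columns⇒occurs (suc c) v∈ = ∈column⇒occurs V (subst (_ ∈_) (row-columns V c) v∈)

  occurs⇒∈columns : ∀ c → OccursIn V c v → v ∈ row (columns V) c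
  occurs⇒∈columns c (r , eq) with ‼-index {c = c} (row V r) eq
  ... | c , refl = subst (_ ∈_) (sym (row-columns V c)) (occurs⇒∈column V (r , eq))

  ⊆ᶜ⇒Positive : X ⊆ᶜ V → Positive X
  ⊆ᶜ⇒Positive X⊆V = All.tabulate λ R∈ → All.tabulate λ v∈ →
    let r , row≡ = ∈⇒row R∈ ; c , eqv = ∈⇒‼ v∈
        s , eqs = X⊆V (suc r , trans (cong (_‼ suc c) row≡) eqv)
    in All.lookup (All⇒row [] positive s) (‼⇒∈ (row V s) eqs)

  ψ-QKT¹ : QKT¹ (ψ V) × ψ V ≈ᶜ V
  ψ-QKT¹ with rowFill-Filled (length (concat V)) columns-≽-Linked
                (All.map⁺ (All.universal (λ _ → Unique-column {V} λ
                  {r} {s} {c} → RevSSYT-columns-distinct {r} {s} {c}) _))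
                (subst (λ C → length C ≤ length (concat V)) (sym (row-columns V 0)) (column≤size V))
    where
    column≤size : ∀ V → length (column V 1) ≤ length (concat V)
    column≤size []            = z≤n
    column≤size ([] ∷ V)      = column≤size V
    column≤size ((y ∷ R) ∷ V) = s≤s (≤-trans (column≤size V)
      (subst (length (concat V) ≤_) (sym (length-++ R)) (m≤n+m _ (length R))))
  ... | L , eq , nonempty , decreasing , beating , L⊆ , ⊆L =
    subst (λ X → QKT¹ X × X ≈ᶜ V) (sym eq) (placeAll-QKT¹ , ≈ᶜ-trans placeAll-≈ᶜ
      (mutual-⊆ᶜ (λ {c} occ → ∈columns⇒occurs c (L⊆ occ)) (λ {c} occ → ⊆L (occurs⇒∈columns c occ))))
    where
    rowOrder : RowOrder L
    rowOrder = record
      { rows-nonempty = nonempty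
      ; rows-positive = ⊆ᶜ⇒Positive {L} λ {c} occ → ∈columns⇒occurs c (L⊆ occ)
      ; rows-decrease = decreasing
      ; rows-beat     = beating
      }
    open FromRowOrder rowOrder

-- Semi-skyline fillings

-- What remains of the triple conditions once the shape is forgotten: an entry that could have been
-- placed in a lower row found that place taken by a larger entry.
Packed : Pred Filling 0ℓ
Packed X = ∀ r s c {δ α} → r < s → cell X s (suc (suc c)) ≡ just α → cell X r (suc c) ≡ just δ → α ≤ δ →
           ∃[ β ] cell X r (suc (suc c)) ≡ just β × α < β

-- The triple conditions depend on row lengths, which change while columns are being filled. These
-- fields do not, and hold at every stage of `Γ`.
record Skyline (X : Filling) : Set where
  field
    composition-shape : NoTrailingEmptyRow X
    rows-decrease     : RowsWeaklyDecrease X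
    columns-distinct  : ColumnsDistinct X
    packed            : Packed X
    first-column      : FirstColumnIsRowIndex X

  row-decreases : ∀ r → Linked _≥_ (row X r)
  row-decreases = All⇒row [] rows-decrease

  same-row : ∀ {r s c v} → cell X r c ≡ just v → cell X s c ≡ just v → r ≡ s
  same-row {r} {s} {c} eq eq′ with <-cmp r s
  ... | tri< r<s _ _ = contradiction refl (columns-distinct {r} {s} {c} r<s eq eq′)
  ... | tri≈ _ r≡s _ = r≡s
  ... | tri> _ _ s<r = contradiction refl (columns-distinct {s} {r} {c} s<r eq′ eq)

-- A pair `α ≤ δ` as in `Packed` cannot occur when the upper row is longer, by `separated`.
-- Otherwise the lower row reaches the column of `α`, and the type A triple leaves only `α < β`.
ASSF⇒Skyline : ASSF X → Skyline X
ASSF⇒Skyline {X} a = record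
  { composition-shape = composition-shape
  ; rows-decrease     = rows-decrease
  ; columns-distinct  = columns-distinct
  ; packed            = packed
  ; first-column      = first-column
  }
  where
  open ASSF a

  row-decreases : ∀ r → Linked _≥_ (row X r)
  row-decreases = All⇒row [] rows-decrease

  -- In a type B triple the unwanted alternative is `γ < δ`. In the first column it reverses the
  -- order of the row indices; later it contradicts the preceding column, where `δ′ < γ` and
  -- `δ ≤ δ′`.
  separated : ∀ {r s} → r < s → rowLength X r < rowLength X s → ∀ c {δ α} →
              cell X r (suc c) ≡ just δ → cell X s (suc (suc c)) ≡ just α → δ < α
  separated {r} {s} r<s len zero eqδ eqα
    with decreasing-pred (row-decreases s) eqα
  ... | γ , eqγ , _ with type-B {r} {s} {1} r<s len eqγ eqα eqδ
  ...   | inj₂ (_ , δ<α) = δ<α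
  ...   | inj₁ (γ<δ , _) = contradiction
    (subst₂ _<_ (first-column {s} eqγ) (first-column {r} eqδ) γ<δ) (<-asym r<s)
  separated {r} {s} r<s len (suc c) eqδ eqα
    with decreasing-pred (row-decreases s) eqα | decreasing-pred (row-decreases r) eqδ
  ... | γ , eqγ , _ | δ′ , eqδ′ , δ≤δ′ with type-B {r} {s} {suc (suc c)} r<s len eqγ eqα eqδ
  ...   | inj₂ (_ , δ<α) = δ<α
  ...   | inj₁ (γ<δ , _) = contradiction (separated {r} {s} r<s len c eqδ′ eqγ) (≤⇒≯ (≤-trans (<⇒≤ γ<δ) δ≤δ′))

  packed : Packed X
  packed r s c r<s eqα eqδ α≤δ with <-≤-connex (rowLength X r) (rowLength X s)
  ... | inj₁ len = contradiction (separated {r} {s} r<s len c eqδ eqα) (≤⇒≯ α≤δ)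
  ... | inj₂ len with <length⇒‼-just (row X r) (≤-trans (‼-just⇒≤length (row X s) eqα) len)
  ...   | β , eqβ with type-A {r} {s} {suc c} r<s len eqδ eqβ eqα
  ...     | inj₁ (δ<α , _) = contradiction δ<α (≤⇒≯ α≤δ)
  ...     | inj₂ (_ , α<β) = β , eqβ , α<β

Skyline⇒ASSF : Skyline X → Positive X → ASSF X
Skyline⇒ASSF {X} sky pos = record
  { composition-shape = composition-shape
  ; positive          = pos
  ; rows-decrease     = rows-decrease
  ; columns-distinct  = columns-distinct
  ; type-A            = type-A
  ; type-B            = type-B
  ; first-column      = first-column
  }
  where
  open Skyline sky

  type-A : ∀ {r s c γ α β} → r < s → rowLength X r ≥ rowLength X s → cell X r c ≡ just γ →
           cell X r (suc c) ≡ just α → cell X s (suc c) ≡ just β → InversionTriple γ α β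
  type-A {r} {s} {c} {γ} {α} {β} r<s _ eqγ eqα eqβ with ‼-index {c = c} (row X r) eqγ
  ... | d , refl with β ≤? γ
  ...   | no  β≰γ = inj₁ (≰⇒> β≰γ , Linked⇒pair (row-decreases r) eqγ eqα)
  ...   | yes β≤γ = let _ , eq , β< = packed r s d r<s eqβ eqγ β≤γ in
    inj₂ (Linked⇒pair (row-decreases r) eqγ eqα , subst (β <_) (just-injective (trans (sym eq) eqα)) β<)

  -- An inequality `α ≤ β` propagates to the right: `packed` yields `β′ > α`, and the next entry of
  -- row `s` is at most `α`. So the lower row keeps pace until row `s` ends, which excludes a longer
  -- row `s` in type B. The number `k` bounds the columns still to come.
  reach : ∀ {r s} → r < s → ∀ k c {α β} → rowLength X s ≤ k + suc (suc c) → cell X s (suc (suc c)) ≡ just α →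
          cell X r (suc c) ≡ just β → α ≤ β → rowLength X s ≤ rowLength X r
  reach {r} {s} r<s k c len eqα eqβ α≤β with packed r s c r<s eqα eqβ α≤β
  reach {r} {s} r<s zero    c len eqα eqβ α≤β | β′ , eqβ′ , α<β′ = ≤-trans len (‼-just⇒≤length (row X r) eqβ′)
  reach {r} {s} r<s (suc k) c len eqα eqβ α≤β | β′ , eqβ′ , α<β′ with suc (suc c) <? rowLength X s
  ... | no  ≮ = ≤-trans (≮⇒≥ ≮) (‼-just⇒≤length (row X r) eqβ′)
  ... | yes < with <length⇒‼-just (row X s) <
  ...   | α′ , eqα′ = reach r<s k (suc c) (subst (rowLength X s ≤_) (sym (+-suc k (suc (suc c)))) len) eqα′ eqβ′
                        (≤-trans (Linked⇒pair (row-decreases s) eqα eqα′) (<⇒≤ α<β′))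

  type-B : ∀ {r s c γ α β} → r < s → rowLength X s > rowLength X r → cell X s c ≡ just γ →
           cell X s (suc c) ≡ just α → cell X r c ≡ just β → InversionTriple γ α β
  type-B {r} {s} {c} {γ} {α} {β} r<s len eqγ eqα eqβ with ‼-index {c = c} (row X r) eqβ
  ... | d , refl with α ≤? β
  ...   | no  α≰β = inj₂ (Linked⇒pair (row-decreases s) eqγ eqα , ≰⇒> α≰β)
  ...   | yes α≤β = contradiction (reach {r} {s} r<s (rowLength X s) d (m≤m+n _ _) eqα eqβ α≤β) (<⇒≱ len)

-- Compare the lowest rows in which the entries of a column differ: each of the two entries would
-- have to be larger than the other.
Skyline-next-cell : ∀ {X Y} n c → Skyline X → Skyline Y → X ⊆ᶜ Y → Y ⊆ᶜ X →
  (∀ r v → cell X r (suc c) ≡ just v → cell Y r (suc c) ≡ just v) →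
  (∀ r v → cell Y r (suc c) ≡ just v → cell X r (suc c) ≡ just v) →
  ∀ r v → r < n → cell X r (suc (suc c)) ≡ just v → cell Y r (suc (suc c)) ≡ just v
Skyline-next-cell {X} {Y} (suc n) c sX sY X⊆Y Y⊆X X⇒Y Y⇒X r v (s≤s r≤n) eq with X⊆Y (r , eq)
... | s , eqs with <-cmp s r
... | tri≈ _ refl _ = eqs
... | tri< s<r _ _ = contradiction
  (Skyline.same-row sX {c = suc (suc c)} (Skyline-next-cell n c sY sX Y⊆X X⊆Y Y⇒X X⇒Y s v (≤-trans s<r r≤n) eqs) eq)
  (<⇒≢ s<r)
... | tri> _ _ r<s with decreasing-pred (Skyline.row-decreases sX r) eq
... | δ , eqδ , v≤δ with Skyline.packed sY r s c r<s eqs (X⇒Y r δ eqδ) v≤δ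
... | β , eqβ , v<β with Y⊆X (r , eqβ)
... | s′ , eqs′ with <-cmp s′ r
... | tri≈ _ refl _ = contradiction (just-injective (trans (sym eq) eqs′)) (<⇒≢ v<β)
... | tri< s′<r _ _ = contradiction
  (Skyline.same-row sY {c = suc (suc c)} (Skyline-next-cell n c sX sY X⊆Y Y⊆X X⇒Y Y⇒X s′ β (≤-trans s′<r r≤n) eqs′) eqβ)
  (<⇒≢ s′<r)
... | tri> _ _ r<s′ =
  let _ , eq′ , β< = Skyline.packed sX r s′ c r<s′ eqs′ eqδ
                       (Linked⇒pair (Skyline.row-decreases sY r) (X⇒Y r δ eqδ) eqβ)
  in contradiction (subst (β <_) (just-injective (trans (sym eq′) eq)) β<) (<-asym v<β)

Skyline-cell : ∀ {X Y} c → Skyline X → Skyline Y → X ⊆ᶜ Y → Y ⊆ᶜ X →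
               ∀ r v → cell X r (suc c) ≡ just v → cell Y r (suc c) ≡ just v
Skyline-cell {X} {Y} zero sX sY X⊆Y Y⊆X r v eq with X⊆Y (r , eq)
... | s , eqs with refl ← trans (sym (Skyline.first-column sX {r} eq)) (Skyline.first-column sY {s} eqs) = eqs
Skyline-cell (suc c) sX sY X⊆Y Y⊆X r v =
  Skyline-next-cell (suc r) c sX sY X⊆Y Y⊆X
    (Skyline-cell c sX sY X⊆Y Y⊆X) (Skyline-cell c sY sX Y⊆X X⊆Y) r v ≤-refl

Skyline-unique : Skyline X → Skyline Y → X ≈ᶜ Y → X ≡ Y
Skyline-unique {X} {Y} sX sY (mutual-⊆ᶜ X⊆Y Y⊆X) =
  filling-ext (Skyline.composition-shape sX) (Skyline.composition-shape sY)
    (λ {r} {c} {v} → cells sX sY X⊆Y Y⊆X r c v) (λ {r} {c} {v} → cells sY sX Y⊆X X⊆Y r c v)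
  where
  cells : ∀ {X Y} → Skyline X → Skyline Y → X ⊆ᶜ Y → Y ⊆ᶜ X →
          ∀ r c v → cell X r c ≡ just v → cell Y r c ≡ just v
  cells {X} sX sY X⊆Y Y⊆X r c v eq with ‼-index {c = c} (row X r) eq
  ... | d , refl = Skyline-cell d sX sY X⊆Y Y⊆X r v eq

-- Column-filling

freeEntry : ℕ → List ℕ → List ℕ
freeEntry c R with R ‼ c | R ‼ suc c
... | just v | nothing = v ∷ []
... | _      | _       = []

-- The places still on offer in the next column, each given by the bound it puts on an entry. That
-- they dominate the waiting entries is the invariant within a column.
openEntries : ℕ → Filling → List ℕ
openEntries c = concatMap (freeEntry c)

count≥-++ : ∀ C D → count≥ t (C ++ D) ≡ count≥ t C + count≥ t D
count≥-++ {t} C D = trans (cong length (filter-++ (t ≤?_) C D)) (length-++ (filter (t ≤?_) C))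

-- `lowest` becomes `packed` for the new entry; `opens` says that a placement uses up at most one
-- place, which leaves enough for the entries after it.
record Placed (c x : ℕ) (X X′ : Filling) (r : ℕ) : Set where
  field
    room   : ∃[ v ] cell X r c ≡ just v × x ≤ v
    free   : cell X r (suc c) ≡ nothing
    new    : row X′ r ≡ row X r ++ x ∷ []
    other  : ∀ s → s ≢ r → row X′ s ≡ row X s
    lowest : ∀ s v → s < r → cell X s c ≡ just v → x ≤ v → ∃[ w ] cell X s (suc c) ≡ just w
    opens  : ∀ t → count≥ t (openEntries c X) ≤ suc (count≥ t (openEntries c X′))
    shape  : NoTrailingEmptyRow X → NoTrailingEmptyRow X′

fits-view : ∀ x R c → (fits x (R ‼ c) (R ‼ suc c) ≡ true × ∃[ v ] R ‼ c ≡ just v × R ‼ suc c ≡ nothing × x ≤ v)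
                    ⊎ (fits x (R ‼ c) (R ‼ suc c) ≡ false ×
                       (∀ v → R ‼ c ≡ just v → x ≤ v → ∃[ w ] R ‼ suc c ≡ just w))
fits-view x R c with R ‼ c | R ‼ suc c
... | nothing | _       = inj₂ (refl , λ v ())
... | just v  | just w  = inj₂ (refl , λ _ _ _ → w , refl)
... | just v  | nothing with x ≤ᵇ v in eq
...   | true  = inj₁ (refl , v , refl , refl , ≤ᵇ⇒≤ x v (subst T (sym eq) _))
...   | false = inj₂ (refl , λ { _ refl x≤v → contradiction (subst T eq (≤⇒≤ᵇ x≤v)) id })


-- The count asserts that some vacant place admits `x`; without one, `placeEntry` would drop `x`
-- silently.
placeEntry-Placed : ∀ c x X → 0 < count≥ x (openEntries c X) → ∃[ r ] Placed c x X (placeEntry c X x) (suc r)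
placeEntry-Placed c x (R ∷ X) 0< with fits-view x R c
... | inj₁ (fit , v , eqv , eq∅ , x≤v) rewrite fit = 0 , record
  { room   = v , eqv , x≤v
  ; free   = eq∅
  ; new    = refl
  ; other  = λ { zero _ → refl ; (suc zero) ne → contradiction refl ne ; (suc (suc s)) _ → refl }
  ; lowest = λ { zero _ _ () ; (suc s) _ (s≤s ()) }
  ; opens  = opens
  ; shape  = shape X
  }
  where
  at-most-one : ∀ t R → count≥ t (freeEntry c R) ≤ 1
  at-most-one t R = ≤-trans (length-filter (t ≤?_) (freeEntry c R)) (singleton R)
    where
    singleton : ∀ R → length (freeEntry c R) ≤ 1
    singleton R with R ‼ c | R ‼ suc c
    ... | just _  | nothing = s≤s z≤n
    ... | just _  | just _  = z≤n
    ... | nothing | _       = z≤n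
  opens : ∀ t → count≥ t (freeEntry c R ++ openEntries c X) ≤
                suc (count≥ t (freeEntry c (R ++ x ∷ []) ++ openEntries c X))
  opens t rewrite count≥-++ {t} (freeEntry c R) (openEntries c X)
                | count≥-++ {t} (freeEntry c (R ++ x ∷ [])) (openEntries c X) =
    +-mono-≤ (at-most-one t R) (m≤n+m _ (count≥ t (freeEntry c (R ++ x ∷ []))))
  shape : ∀ X → NoTrailingEmptyRow (R ∷ X) → NoTrailingEmptyRow ((R ++ x ∷ []) ∷ X)
  shape []      n eq = contradiction (cong length (just-injective eq))
                         (subst (_≢ 0) (sym (length-++ R)) (m+1+n≢0 (length R)))
  shape (_ ∷ X) n eq = n eq
... | inj₂ (unfit , taken) rewrite unfit with placeEntry-Placed c x X later
  where
  none : (∀ v → R ‼ c ≡ just v → x ≤ v → ∃[ w ] R ‼ suc c ≡ just w) → count≥ x (freeEntry c R) ≡ 0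
  none taken with R ‼ c | R ‼ suc c | taken
  ... | nothing | _       | _     = refl
  ... | just _  | just _  | _     = refl
  ... | just v  | nothing | taken = count≥-reject [] (≰⇒> λ x≤v → contradiction (proj₂ (taken v refl x≤v)) λ ())
  later : 0 < count≥ x (openEntries c X)
  later = subst (0 <_) (trans (count≥-++ (freeEntry c R) (openEntries c X)) (cong (_+ _) (none taken))) 0<
... | r , p = suc r , record
  { room   = room
  ; free   = free
  ; new    = new
  ; other  = λ { zero _ → refl ; (suc zero) _ → refl ; (suc (suc s)) ne → other (suc s) (ne ∘ cong suc) }
  ; lowest = λ { zero _ _ () ; (suc zero) v _ eq x≤v → taken v eq x≤v
               ; (suc (suc s)) v (s≤s s<r) eq x≤v → lowest (suc s) v s<r eq x≤v }
  ; opens  = opens′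
  ; shape  = shape′ X (placeEntry c X x) new shape
  }
  where
  open Placed p
  opens′ : ∀ t → count≥ t (freeEntry c R ++ openEntries c X) ≤
                 suc (count≥ t (freeEntry c R ++ openEntries c (placeEntry c X x)))
  opens′ t rewrite count≥-++ {t} (freeEntry c R) (openEntries c X)
                 | count≥-++ {t} (freeEntry c R) (openEntries c (placeEntry c X x))
                 | sym (+-suc (count≥ t (freeEntry c R)) (count≥ t (openEntries c (placeEntry c X x)))) =
    +-monoʳ-≤ (count≥ t (freeEntry c R)) (opens t)
  shape′ : ∀ X X′ → row X′ (suc r) ≡ row X (suc r) ++ x ∷ [] → (NoTrailingEmptyRow X → NoTrailingEmptyRow X′) →
           NoTrailingEmptyRow (R ∷ X) → NoTrailingEmptyRow (R ∷ X′)
  shape′ X       []       new sh n = contradiction (cong length new)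
    (≢-sym (subst (_≢ 0) (sym (length-++ (row X (suc r)))) (m+1+n≢0 (length (row X (suc r))))))
  shape′ []      (_ ∷ _)  new sh n = sh λ ()
  shape′ (_ ∷ X) (_ ∷ X′) new sh n = sh n

Linked-snoc : Linked _≥_ R → R ‼ length R ≡ just v → x ≤ v → Linked _≥_ (R ++ x ∷ [])
Linked-snoc []      eq   x≤v = [-]
Linked-snoc [-]     refl x≤v = x≤v ∷ [-]
Linked-snoc (p ∷ l) eq   x≤v = p ∷ Linked-snoc l eq x≤v

Within : ℕ → Filling → Set
Within c X = ∀ r d {v} → cell X r d ≡ just v → d ≤ c

record Extends (c : ℕ) (E : List ℕ) (X X′ : Filling) : Set where
  field
    skyline : Skyline X′
    within  : Within (suc c) X′
    old     : X ⊆ᶜ X′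
    new     : v ∈ E → OccursIn X′ (suc c) v
    inv     : ∀ {d v} → OccursIn X′ d v → OccursIn X d v ⊎ (d ≡ suc c × v ∈ E)

-- Entries of a column arrive in decreasing order, so `x` is below everything already in its column.
-- This gives distinctness, and `packed` for the new entry. The column filled is `suc (suc c)`, so
-- the first column is never touched.
placeEntry-Extends : ∀ c x X → Skyline X → Within (suc (suc c)) X →
  (∀ {w} → OccursIn X (suc (suc c)) w → x < w) → 0 < count≥ x (openEntries (suc c) X) →
  Extends (suc c) (x ∷ []) X (placeEntry (suc c) X x)
placeEntry-Extends c x X sky within larger 0< with placeEntry-Placed (suc c) x X 0<
... | q , p = record
  { skyline = record
    { composition-shape = shape composition-shape
    ; rows-decrease     = row⇒All decreasing
    ; columns-distinct  = distinct
    ; packed            = packed′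
    ; first-column      = first
    }
  ; within = within′
  ; old    = λ (s , eq) → s , old s _ eq
  ; new    = λ { (here refl) → ρ , new-cell }
  ; inv    = inv
  }
  where
  open Skyline sky
  open Placed p
  ρ : ℕ
  ρ = suc q
  X′ : Filling
  X′ = placeEntry (suc c) X x

  length-ρ : length (row X ρ) ≡ suc c
  length-ρ = ≤-antisym
    (≮⇒≥ λ c< → just≢nothing (proj₂ (<length⇒‼-just (row X ρ) c<)) free)
    (‼-just⇒≤length (row X ρ) (proj₁ (proj₂ room)))

  new-cell : cell X′ ρ (suc (suc c)) ≡ just x
  new-cell = trans (cong₂ _‼_ new (cong suc (sym length-ρ))) (‼-snoc-new (row X ρ))

  old : ∀ s d {v} → cell X s d ≡ just v → cell X′ s d ≡ just v
  old s d eq with s ≟ ρ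
  ... | no  ne   = trans (cong (_‼ d) (other s ne)) eq
  ... | yes refl = trans (cong (_‼ d) new) (trans (‼-snoc-old (row X ρ) (‼-just⇒≤length (row X ρ) eq)) eq)

  within-new : ∀ d {v} → cell X′ ρ d ≡ just v → d ≤ suc (suc c)
  within-new d eq = subst (d ≤_)
    (trans (cong length new) (trans (length-++ (row X ρ)) (trans (+-comm _ 1) (cong suc length-ρ))))
    (‼-just⇒≤length (row X′ ρ) eq)

  cell-inv : ∀ s d {v} → cell X′ s d ≡ just v → cell X s d ≡ just v ⊎ (s ≡ ρ × d ≡ suc (suc c) × v ≡ x)
  cell-inv s d eq with s ≟ ρ
  ... | no  ne   = inj₁ (trans (cong (_‼ d) (sym (other s ne))) eq)
  ... | yes refl with d ≤? length (row X ρ)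
  ...   | yes d≤ = inj₁ (trans (sym (‼-snoc-old (row X ρ) d≤)) (trans (cong (_‼ d) (sym new)) eq))
  ...   | no  d≰ with refl ← ≤-antisym (within-new d eq) (subst (_< d) length-ρ (≰⇒> d≰)) =
    inj₂ (refl , refl , just-injective (trans (sym eq) new-cell))

  decreasing : ∀ s → Linked _≥_ (row X′ s)
  decreasing s with s ≟ ρ
  ... | no  ne   = subst (Linked _≥_) (sym (other s ne)) (row-decreases s)
  ... | yes refl = let _ , eq , x≤v = room in subst (Linked _≥_) (sym new)
    (Linked-snoc (row-decreases ρ) (trans (cong (row X ρ ‼_) length-ρ) eq) x≤v)

  distinct : ColumnsDistinct X′
  distinct {s} {s′} {d} s<s′ eq eq′ with cell-inv s d eq | cell-inv s′ d eq′
  ... | inj₁ e               | inj₁ e′               = columns-distinct {s} {s′} {d} s<s′ e e′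
  ... | inj₁ e               | inj₂ (_ , refl , refl) = >⇒≢ (larger (s , e))
  ... | inj₂ (_ , refl , refl) | inj₁ e′              = <⇒≢ (larger (s′ , e′))
  ... | inj₂ (refl , _)       | inj₂ (refl , _)        = contradiction s<s′ (<-irrefl refl)

  first : FirstColumnIsRowIndex X′
  first {s} eq with cell-inv s 1 eq
  ... | inj₁ e = first-column e
  ... | inj₂ (_ , () , _)

  packed′ : Packed X′
  packed′ s s′ d s<s′ eqα eqδ α≤δ with cell-inv s′ (suc (suc d)) eqα | cell-inv s (suc d) eqδ
  ... | inj₁ eα | inj₁ eδ = let β , eqβ , α<β = packed s s′ d s<s′ eα eδ α≤δ in β , old s _ eqβ , α<β
  ... | inj₁ eα | inj₂ (_ , refl , _) = contradiction (within s′ _ eα) 1+n≰n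
  -- The lower place admits `x` by size, so by `lowest` it is occupied, and its earlier occupant is
  -- larger than `x`.
  ... | inj₂ (refl , refl , refl) | inj₁ eδ =
    let w , eqw = lowest s _ s<s′ eδ α≤δ in w , old s _ eqw , larger (s , eqw)
  ... | inj₂ (refl , _) | inj₂ (refl , _) = contradiction s<s′ (<-irrefl refl)

  within′ : Within (suc (suc c)) X′
  within′ s d eq with cell-inv s d eq
  ... | inj₁ e             = within s d e
  ... | inj₂ (_ , refl , _) = ≤-refl

  inv : ∀ {d v} → OccursIn X′ d v → OccursIn X d v ⊎ (d ≡ suc (suc c) × v ∈ x ∷ [])
  inv {d} (s , eq) with cell-inv s d eq
  ... | inj₁ e                = inj₁ (s , e)
  ... | inj₂ (_ , d≡ , refl) = inj₂ (d≡ , here refl)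

-- The largest waiting entry `x` goes first. At thresholds up to `x` its placement lowers the count
-- of waiting entries by one and that of open places by at most one; above `x` nothing waits any
-- more.
placeColumn-Extends : ∀ c C X → AllPairs _>_ C → Skyline X → Within (suc (suc c)) X →
  (∀ {x w} → x ∈ C → OccursIn X (suc (suc c)) w → x < w) → openEntries (suc c) X ≽ C →
  Extends (suc c) C X (foldl (placeEntry (suc c)) X C)
placeColumn-Extends c []      X _        sky within _      _  = record
  { skyline = sky ; within = within ; old = id ; new = λ () ; inv = inj₁ }
placeColumn-Extends c (x ∷ C) X (p ∷ ps) sky within larger ge = record
  { skyline = R.skyline
  ; within  = R.within
  ; old     = R.old ∘ S.old
  ; new     = λ { (here refl) → R.old (S.new (here refl)) ; (there v∈) → R.new v∈ }
  ; inv     = inv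
  }
  where
  0< : 0 < count≥ x (openEntries (suc c) X)
  0< = ≤-trans (∈⇒count≥ {C = x ∷ C} (here refl) ≤-refl) (ge x)
  X′ : Filling
  X′ = placeEntry (suc c) X x
  module S = Extends (placeEntry-Extends c x X sky within (larger (here refl)) 0<)

  larger′ : ∀ {y w} → y ∈ C → OccursIn X′ (suc (suc c)) w → y < w
  larger′ y∈ occ with S.inv occ
  ... | inj₁ occ′            = larger (there y∈) occ′
  ... | inj₂ (_ , here refl) = All.lookup p y∈

  ge′ : openEntries (suc c) X′ ≽ C
  ge′ t with t ≤? x
  ... | no  t≰x = ≤-trans (≤-reflexive (count≥-none (All.map (λ y<x → <-trans y<x (≰⇒> t≰x)) p))) z≤n
  ... | yes t≤x = ≤-pred (≤-trans (subst (_≤ _) (count≥-accept C t≤x) (ge t))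
                                  (Placed.opens (proj₂ (placeEntry-Placed (suc c) x X 0<)) t))

  module R = Extends (placeColumn-Extends c C X′ ps S.skyline S.within larger′ ge′)

  inv : ∀ {d v} → OccursIn (foldl (placeEntry (suc c)) X′ C) d v →
        OccursIn X d v ⊎ (d ≡ suc (suc c) × v ∈ x ∷ C)
  inv occ with R.inv occ
  ... | inj₂ (d≡ , v∈) = inj₂ (d≡ , there v∈)
  ... | inj₁ occ′ with S.inv occ′
  ...   | inj₁ occ″             = inj₁ occ″
  ...   | inj₂ (d≡ , here refl) = inj₂ (d≡ , here refl)

openEntries≡column : ∀ c X → (∀ r → cell X r (suc c) ≡ nothing) → openEntries c X ≡ column X c
openEntries≡column c []      none = refl
openEntries≡column c (R ∷ X) none with R ‼ c | R ‼ suc c | none 1 | openEntries≡column c X tail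
  where
  tail : ∀ r → cell X r (suc c) ≡ nothing
  tail zero    = cong (_‼ suc c) (row-zero X)
  tail (suc r) = none (suc (suc r))
... | just v  | nothing | _ | eq = cong (v ∷_) eq
... | nothing | _       | _ | eq = eq

record Completes (c : ℕ) (Cs : List (List ℕ)) (X X′ : Filling) : Set where
  field
    skyline : Skyline X′
    old     : X ⊆ᶜ X′
    new     : ∀ k {v} → v ∈ row Cs (suc k) → OccursIn X′ (c + suc k) v
    inv     : ∀ {d v} → OccursIn X′ d v → OccursIn X d v ⊎ ∃[ k ] d ≡ c + suc k × v ∈ row Cs (suc k)

-- Before a column is begun, every entry of the preceding column is open, so the domination between
-- successive columns of the tableau starts the invariant of `placeColumn-Extends`.
columnFill-Completes : ∀ c C Cs X → Skyline X → Within (suc c) X → (∀ {v} → v ∈ C → OccursIn X (suc c) v) →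
  Linked _≽_ (C ∷ Cs) → All (AllPairs _>_) (C ∷ Cs) → Completes (suc c) Cs X (columnFill (suc c) X Cs)
columnFill-Completes c C [] X sky _ _ _ _ = record { skyline = sky ; old = id ; new = λ k () ; inv = inj₁ }
columnFill-Completes c C (D ∷ Cs) X sky within C⊆ (C≽D ∷ ge) (pC ∷ pD ∷ ps) = record
  { skyline = R.skyline
  ; old     = R.old ∘ S.old
  ; new     = new
  ; inv     = inv
  }
  where
  none : ∀ r → cell X r (suc (suc c)) ≡ nothing
  none r with cell X r (suc (suc c)) in eq
  ... | nothing = refl
  ... | just _  = contradiction (within r _ eq) 1+n≰n

  open≽D : openEntries (suc c) X ≽ D
  open≽D t = ≤-trans (C≽D t) (subst (_ ≤_) (cong (count≥ t) (sym (openEntries≡column (suc c) X none)))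
    (⊆⇒≽ (>⇒Unique pC) (λ v∈ → occurs⇒∈column X (C⊆ v∈)) t))

  module S = Extends (placeColumn-Extends c D X pD sky (λ r d eq → m≤n⇒m≤1+n (within r d eq))
    (λ _ (r , eq) → contradiction (none r) (just≢nothing eq)) open≽D)
  module R = Completes (columnFill-Completes (suc c) D Cs _ S.skyline S.within S.new ge (pD ∷ ps))

  new : ∀ k {v} → v ∈ row (D ∷ Cs) (suc k) → OccursIn (columnFill (suc c) X (D ∷ Cs)) (suc c + suc k) v
  new zero    v∈ rewrite +-comm c 1 = R.old (S.new v∈)
  new (suc k) v∈ rewrite +-suc c (suc k) = R.new k v∈

  inv : ∀ {d v} → OccursIn (columnFill (suc c) X (D ∷ Cs)) d v →
        OccursIn X d v ⊎ ∃[ k ] d ≡ suc c + suc k × v ∈ row (D ∷ Cs) (suc k)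
  inv occ with R.inv occ
  ... | inj₂ (k , refl , v∈) = inj₂ (suc k , cong suc (sym (+-suc c (suc k))) , v∈)
  ... | inj₁ occ′ with S.inv occ′
  ...   | inj₁ occ″          = inj₁ occ″
  ...   | inj₂ (refl , v∈) = inj₂ (0 , cong suc (+-comm 1 c) , v∈)

-- Images of reverse tableaux under `Γ`

module _ {V : Filling} (ssyt : RevSSYT V) where
  open RevSSYT ssyt

  columns-> : All (AllPairs _>_) (columns V)
  columns-> = All.map⁺ (All.universal (λ c → AllPairs-column V (cells⇒AllPairs V λ
    {r} {s} → columns-decrease {r} {s})) _)

  -- The first column consists of one-entry rows placed by their heads, so `foldr-map` turns it into
  -- a `placeAll`. `packed` is vacuous because column 2 is empty.
  firstColumn-Skyline : ∀ {C Cs} → columns V ≡ C ∷ Cs →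
    Skyline (firstColumn C) × Within 1 (firstColumn C) × firstColumn C ≈ᶜ map (_∷ []) C
  firstColumn-Skyline {C} {Cs} eqC = subst (λ X → Skyline X × Within 1 X × X ≈ᶜ L) (foldr-map place (_∷ []) [] C)
    ( record
      { composition-shape = placeAll-NoTrailingEmptyRow
      ; rows-decrease     = row⇒All decreasing
      ; columns-distinct  = λ {r} {s} {c} → distinct r s c
      ; packed            = λ r s c _ eq → contradiction (within s _ eq) λ { (s≤s ()) }
      ; first-column      = placeAll-first-column
      }
    , within , placeAll-≈ᶜ )
    where
    L : List (List ℕ)
    L = map (_∷ []) C
    heads-distinct : AllPairs (Cellwise _≢_ 1) L
    heads-distinct = AllPairs.map⁺ (AllPairs.map (λ { x>y _ _ refl refl → >⇒≢ x>y })
      (All.head (subst (All (AllPairs _>_)) eqC columns->)))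
    L-positive : All (All (0 <_)) L
    L-positive = All.map⁺ (All.tabulate λ v∈ →
      let r , eq = ∈columns⇒occurs ssyt 1 (subst (λ Cs → _ ∈ row Cs 1) (sym eqC) v∈)
      in All.lookup (All⇒row [] positive r) (‼⇒∈ (row V r) eq) ∷ [])
    open Placing heads-distinct L-positive
    singleton : ∀ r → row (placeAll L) r ≡ [] ⊎ ∃[ x ] row (placeAll L) r ≡ x ∷ []
    singleton r with row-placeAll⁻ r
    ... | inj₁ eq       = inj₁ eq
    ... | inj₂ (R∈ , _) = let x , _ , eq = ∈-map⁻ (_∷ []) R∈ in inj₂ (x , eq)
    decreasing : ∀ r → Linked _≥_ (row (placeAll L) r)
    decreasing r with singleton r
    ... | inj₁ eq       = subst (Linked _≥_) (sym eq) []
    ... | inj₂ (x , eq) = subst (Linked _≥_) (sym eq) [-]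
    within : Within 1 (placeAll L)
    within r d eq with singleton r
    ... | inj₁ eq′       = ≤-trans (subst (λ R → d ≤ length R) eq′ (‼-just⇒≤length (row (placeAll L) r) eq)) z≤n
    ... | inj₂ (x , eq′) = subst (λ R → d ≤ length R) eq′ (‼-just⇒≤length (row (placeAll L) r) eq)
    distinct : ∀ r s c {v w} → r < s →
               cell (placeAll L) r c ≡ just v → cell (placeAll L) s c ≡ just w → v ≢ w
    distinct r s c r<s eq eq′ with ‼-index {c = c} (row (placeAll L) r) eq | within r c eq
    ... | zero , refl | _ = λ v≡w → <⇒≢ r<s
      (trans (sym (placeAll-first-column {r} eq)) (trans v≡w (placeAll-first-column {s} eq′)))
    ... | suc d , refl | s≤s ()

  Γ-Skyline : Skyline (Γ V) × Γ V ≈ᶜ V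
  Γ-Skyline with columns V in eqC
  ... | [] = record
      { composition-shape = λ ()
      ; rows-decrease     = []
      ; columns-distinct  = λ _ ()
      ; packed            = λ _ _ _ _ ()
      ; first-column      = λ ()
      } , mutual-⊆ᶜ (λ ()) λ {c} occ → contradiction
          (subst (λ Cs → _ ∈ row Cs c) eqC (occurs⇒∈columns ssyt c occ)) λ ()
  ... | C ∷ Cs = F.skyline , mutual-⊆ᶜ to from
    where
    start : Skyline (firstColumn C) × Within 1 (firstColumn C) × firstColumn C ≈ᶜ map (_∷ []) C
    start = firstColumn-Skyline eqC
    C⊆ : ∀ {v} → v ∈ C → OccursIn (firstColumn C) 1 v
    C⊆ v∈ = let r , eq = ∈⇒row (∈-map⁺ (_∷ []) v∈) in
      _≈ᶜ_.⊇ (proj₂ (proj₂ start)) (suc r , cong (_‼ 1) eq)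
    ⊆C : ∀ {d v} → OccursIn (firstColumn C) d v → v ∈ row (C ∷ Cs) d
    ⊆C {d} occ with find (occurs⇒any (map (_∷ []) C) (_≈ᶜ_.⊆ (proj₂ (proj₂ start)) occ))
    ... | R , R∈ , eq with ∈-map⁻ (_∷ []) R∈
    ...   | x , x∈ , refl = entry d eq
      where
      entry : ∀ d {v} → (x ∷ []) ‼ d ≡ just v → v ∈ row (C ∷ Cs) d
      entry (suc zero) refl = x∈

    module F = Completes (columnFill-Completes 0 C Cs (firstColumn C) (proj₁ start) (proj₁ (proj₂ start)) C⊆
      (subst (Linked _≽_) eqC (columns-≽-Linked ssyt)) (subst (All (AllPairs _>_)) eqC columns->))

    to : columnFill 1 (firstColumn C) Cs ⊆ᶜ V
    to {c} occ = ∈columns⇒occurs ssyt c (subst (λ Cs → _ ∈ row Cs c) (sym eqC) (in-column occ))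
      where
      in-column : ∀ {c v} → OccursIn (columnFill 1 (firstColumn C) Cs) c v → v ∈ row (C ∷ Cs) c
      in-column occ with F.inv occ
      ... | inj₁ occ′            = ⊆C occ′
      ... | inj₂ (k , refl , v∈) = v∈
    from : V ⊆ᶜ columnFill 1 (firstColumn C) Cs
    from {c} occ = fill c (subst (λ Cs → _ ∈ row Cs c) eqC (occurs⇒∈columns ssyt c occ))
      where
      fill : ∀ c {v} → v ∈ row (C ∷ Cs) c → OccursIn (columnFill 1 (firstColumn C) Cs) c v
      fill (suc zero)    v∈ = F.old (C⊆ v∈)
      fill (suc (suc k)) v∈ = F.new k v∈

-- Injectivity comes from the source: `f V` has the column sets of `V`, and these determine a
-- reverse tableau. Surjectivity comes from the target: the tableau with the column sets of `X` is
-- particle-highest along with `X`, and `unique` identifies its image with `X`.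
restricts : {f : Filling → Filling} {Q : Pred Filling 0ℓ} →
  (∀ {V} → RevSSYT V → Q (f V) × f V ≈ᶜ V) →
  (∀ {X Y} → Q X → Q Y → X ≈ᶜ Y → X ≡ Y) →
  (∀ {X} → Q X → RowsWeaklyDecrease X × ColumnsDistinct X × Positive X) →
  RestrictsToBijection f HRevSSYT (Q ∩ ParticleHighest)
restricts {f} image unique fields = record
  { to        = λ (V , p , ph) → let q , fV≈V = image p in f V , q , ParticleHighest-resp (≈ᶜ-sym fV≈V) ph
  ; cong      = cong f
  ; bijective =
      (λ { {V , p , _} {W , p′ , _} fV≡fW → RevSSYT-unique p p′
           (≈ᶜ-trans (≈ᶜ-sym (proj₂ (image p))) (subst (_≈ᶜ W) (sym fV≡fW) (proj₂ (image p′)))) })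
    , (λ (X , q , ph) →
         let rows , distinct , positive = fields q
             V , p , V≈X = RevSSYT-exists X rows distinct positive
             q′ , fV≈V   = image p
         in (V , p , ParticleHighest-resp (≈ᶜ-sym V≈X) ph) ,
            λ z≡V → trans (cong f z≡V) (unique q′ q (≈ᶜ-trans fV≈V V≈X)))
  } , λ V → refl

theorem5p10 : RestrictsToBijection ψ HRevSSYT HQKT¹ × RestrictsToBijection Γ HRevSSYT HSSF
theorem5p10 =
    restricts ψ-QKT¹ QKT¹-unique (λ q → let open QuasiKey (QKT¹.quasiKey q) in
      rows-decrease , (λ {r} {s} {c} → columns-distinct {r} {s} {c}) , positive)
  , restricts (λ p → let sky , Γ≈ = Γ-Skyline p in Skyline⇒ASSF sky (⊆ᶜ⇒Positive p (_≈ᶜ_.⊆ Γ≈)) , Γ≈)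
      (λ a b → Skyline-unique (ASSF⇒Skyline a) (ASSF⇒Skyline b))
      (λ a → let open ASSF a in rows-decrease , (λ {r} {s} {c} → columns-distinct {r} {s} {c}) , positive)
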